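{- There exists a function $f\colon \mathbb{R}_{>0} \to \mathbb{N}$ such that for every $\epsilon>0$ and every positive integer $k$, if $T$ is an $n$-vertex tournament with $n \geq 2k+1+\epsilon k$, then $\mathrm{sinv}_k(T) \leq f(\epsilon)$.
   Context: A tournament is an orientation of a complete graph. For a digraph $D$ and $X \subseteq V(D)$, inverting $X$ means reversing the direction of every arc of $D$ with both endvertices in $X$. A digraph $D$ is $k$-strong if $|V(D)|\ge k+1$ and $D-S$ is strongly connected for every $S\subseteq V(D)$ with $|S|<k$. $\mathrm{sinv}_k(D)$ is the minimum number of sets whose successive inversion transforms $D$ into a $k$-strong digraph. -}

module Defs where

open import Data.Bool using (Bool; if_then_else_; _∧_; not; T; false)
open import Data.Fin using (Fin)
open import Data.Fin.Subset using (Subset; _∉_; ∣_∣)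
open import Data.Fin.Subset.Properties using (_∈?_)
open import Data.Integer using (+_)
open import Data.List using (List; foldl; length)
open import Data.Nat using (ℕ; _≤_; _<_; _+_)
open import Data.Product using (∃-syntax; Σ; _×_; proj₁)
open import Data.Rational as ℚ using (ℚ; 0ℚ)
open import Data.Refinement using (Refinement; value)
open import Level using (0ℓ)
open import Relation.Binary.Bundles using (Setoid)
open import Relation.Binary.Construct.Closure.ReflexiveTransitive using (Star)
import Relation.Binary.Construct.On as On
open import Relation.Binary.PropositionalEquality using (_≡_; _≢_; refl; sym; trans)
open import Relation.Nullary using (¬_; does)

-- A real number x is a Dedekind cut, given by its open lower set
-- { q ∈ ℚ : q < x }.  The lower set is Bool-valued because the real numbers
-- meant here are the classical ones: classically every real number has exactly
-- one such lower set.  With undecidable cuts, a map from ℝ to ℕ respecting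
-- equality of reals could not be shown non-constant without classical axioms.
record ℝ : Set where
  field
    lower     : ℚ → Bool
    inhabited : ∃[ q ] T (lower q)
    bounded   : ∃[ q ] ¬ T (lower q)
    downward  : ∀ {p q} → p ℚ.≤ q → T (lower q) → T (lower p)
    rounded   : ∀ {p} → T (lower p) → ∃[ q ] (p ℚ.< q × T (lower q))

infix 4 _<ᵣ_

_<ᵣ_ : ℚ → ℝ → Set
q <ᵣ x = T (ℝ.lower x q)

ℝ-setoid : Setoid 0ℓ 0ℓ
ℝ-setoid = record
  { Carrier       = ℝ
  ; _≈_           = λ x y → ∀ q → ℝ.lower x q ≡ ℝ.lower y q
  ; isEquivalence = record
    { refl  = λ q → refl
    ; sym   = λ e q → sym (e q)
    ; trans = λ d e q → trans (d q) (e q)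
    }
  }

ℝ>0 : Set
ℝ>0 = Σ ℝ (0ℚ <ᵣ_)

ℝ>0-setoid : Setoid 0ℓ 0ℓ
ℝ>0-setoid = On.setoid ℝ-setoid (proj₁ {B = 0ℚ <ᵣ_})

fromℕ : ℕ → ℚ
fromℕ n = + n ℚ./ 1

-- The inequality c + x k ≤ n between real numbers, for natural c, k, n: since
-- k ≥ 0, the real c + x k is the supremum of c + q k over the rationals q < x.
infix 4 _+_·_≤ᵣ_

_+_·_≤ᵣ_ : ℕ → ℝ → ℕ → ℕ → Set
c + x · k ≤ᵣ n = ∀ q → q <ᵣ x → fromℕ c ℚ.+ q ℚ.* fromℕ k ℚ.≤ fromℕ n

Digraph : Set → Set
Digraph V = V → V → Bool

Arc : ∀ {V} → Digraph V → V → V → Set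
Arc D u v = T (D u v)

record IsTournament {V : Set} (D : Digraph V) : Set where
  field
    loopless : ∀ v → D v v ≡ false
    oriented : ∀ {u v} → u ≢ v → D u v ≡ not (D v u)

StronglyConnected : ∀ {V} → Digraph V → Set
StronglyConnected D = ∀ u v → Star (Arc D) u v

module _ {n : ℕ} where

  -- The proof of v ∉ S is irrelevant, so that D − S has exactly one vertex for
  -- each v outside S.
  infixl 6 _−_

  _−_ : Digraph (Fin n) → (S : Subset n) → Digraph (Refinement (Fin n) (_∉ S))
  (D − S) u v = D (value u) (value v)

  IsStrong : ℕ → Digraph (Fin n) → Set
  IsStrong k D = k + 1 ≤ n × (∀ S → ∣ S ∣ < k → StronglyConnected (D − S))

  invert : Digraph (Fin n) → Subset n → Digraph (Fin n)
  invert D X u v = if does (u ∈? X) ∧ does (v ∈? X) then D v u else D u v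

  invertAll : Digraph (Fin n) → List (Subset n) → Digraph (Fin n)
  invertAll = foldl invert

  -- IsSinv k D m says sinv_k(D) = m.  It is a relation because a digraph that
  -- no inversions make k-strong has no such m.
  record IsSinv (k : ℕ) (D : Digraph (Fin n)) (m : ℕ) : Set where
    field
      attained : ∃[ Xs ] (length Xs ≡ m × IsStrong k (invertAll D Xs))
      minimal  : ∀ Xs → IsStrong k (invertAll D Xs) → m ≤ length Xs

{-# OPTIONS --safe #-}
-- Let 1 / p < ε and encode a tournament by the antisymmetric sign matrix M.
-- Inverting A △ B, A and B reverses exactly the arcs between A and B, so every
-- pattern of reversals between boundedly many vertex classes is available.
--
-- If n is bounded in terms of p, the tournament is turned into a circular one,
-- in which every vertex dominates the next k vertices.
--
-- Otherwise cut the vertices into s classes of nearly equal size and choose the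
-- reversals between class t and the earlier classes greedily, for t = 0, 1, …:
-- vectors w₀, …, w₍s₋₁₎ always admit signs σ with |∑ σᵢ wᵢ|² ≤ ∑ |wᵢ|², so the
-- correlations ∑ᵤ M u v · M u v′ become small in mean square.  By Cauchy–Schwarz
-- M then has small discrepancy on every pair of vertex sets.  Hence few vertices
-- are unbalanced.  In the remaining core, a cut A ⇒ B left by removing fewer
-- than k vertices would have |A| and |B| linear in n (compare the row sums of M
-- over A and over B), contradicting the small discrepancy.  Finally each
-- unbalanced vertex is balanced against the core by signs on the classes, so it
-- keeps a neighbour of either kind in the core after fewer than k deletions.
module Submission where

open import Defs
open import Data.Bool using (Bool; true; false; if_then_else_; _∧_; _∨_; _xor_; not; T)
import Data.Bool
open import Data.Bool.Properties using (T?; T-∧; T-≡; ∧-zeroʳ)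
open import Data.Empty using (⊥; ⊥-elim)
open import Data.Fin using (Fin; zero; suc; toℕ; fromℕ<; inject≤; quotient; combine; _↑ˡ_; _↑ʳ_)
import Data.Fin.Properties as Fin
open import Data.Fin.Subset using (Subset; _∈_; _∉_; _⊃_; ⁅_⁆; _∪_; ∣_∣) renaming (_-_ to _∖_)
open import Data.Fin.Subset.Induction using (⊃-wellFounded; Acc; acc)
open import Data.Fin.Subset.Properties using (_∈?_; x∈⁅x⁆; x∈⁅y⁆⇒x≡y; x∈p∪q⁻; x∈p∪q⁺; anySubset?; p⊆p∪q; x∈p∧x≢y⇒x∈p-y; x∈p⇒∣p-x∣<∣p∣)
import Data.Integer
import Data.Integer.Properties as ℤ
open import Data.Integer.Tactic.RingSolver using (solve-∀)
open import Data.Irrelevant using ([_])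
open import Data.List using (List; []; _∷_; _++_; length)
open import Data.List.Properties using (foldl-++; length-++)
open import Data.Nat as ℕ using (ℕ)
open import Data.Nat.DivMod using (_/_; _%_; m%n<n; m/n*n≤m; m≡m%n+[m/n]*n; %-distribˡ-+; m<n⇒m%n≡m; [m+n]%n≡m%n; m≤n⇒[n∸m]%m≡n%m)
import Data.Nat.Properties as ℕ
open import Data.Product using (Σ; ∃-syntax; _×_; _,_; proj₁; proj₂)
open import Data.Rational as ℚ using (ℚ; 0ℚ; mkℚ)
import Data.Rational.Properties as ℚ
open import Data.Rational.Unnormalised as ℚᵘ using (mkℚᵘ)
import Data.Rational.Unnormalised.Properties as ℚᵘ
open import Data.Refinement using (value; _,_)
open import Data.Sum using (_⊎_; inj₁; inj₂; [_,_]′)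
open import Data.Vec using (tabulate; lookup; []; _∷_)
open import Data.Vec.Properties using (lookup∘tabulate)
open import Function using (_∘_; Equivalence)
open import Function.Bundles using (_⟶ₛ_; _⟨$⟩_)
open import Relation.Binary.Construct.Closure.ReflexiveTransitive using (Star; ε; _◅_; _◅◅_)
open import Relation.Binary.Definitions using (tri<; tri≈; tri>)
open import Relation.Binary.PropositionalEquality
open import Relation.Nullary using (Dec; does; yes; no; ¬?; _×-dec_; _→-dec_; recompute)
open import Relation.Nullary.Decidable using (map′; decidable-stable; dec-true; dec-false)

-- The greedy choice needs correlations that stay small once they are small. The full sums ∑ᵤ M u v
-- · M u v′ would still change later, as they contain arcs to classes not yet treated. Hence `upper`
-- keeps only arcs from lower to higher classes. For v in class t and v′ in an earlier class, each
-- term of the correlation then has one factor being decided at stage t, with the sign of the class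
-- of u, and one factor already final. All these entries are signed combinations of the same s
-- matrices, so one choice of signs serves them all, and later stages leave them alone. Two vertices
-- of one class escape this, as their common sign cancels, but classes of size at most b have at
-- most n b such pairs.
--
-- The slack is n - 2k ≥ n / P with P = 2 p + 1. For a cut A ⇒ B with removed set Z, the row sums
-- give |B| ≤ |Z| + n / h, hence |A| ≥ n - 2 |Z| - n / h, where |Z| exceeds k by at most the number
-- of exceptional vertices. All errors together must stay below n / P; this dictates `h`, `g` and
-- the number 18 g⁴ of classes.

-- Integer inequalities, finite sums and Cauchy-Schwarz.

module IntegerSums where

  open import Data.Integer using (ℤ; +_; -[1+_]; -_; 0ℤ; 1ℤ; _+_; _-_; _*_; _≤_; _<_; +≤+; +<+)
  open import Algebra.Properties.Semiring.Sum ℤ.+-*-semiring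

  ≤-byDifference : ∀ {x y} d → 0ℤ ≤ d → y ≡ x + d → x ≤ y
  ≤-byDifference {x} d 0≤d refl = subst (_≤ x + d) (ℤ.+-identityʳ x) (ℤ.+-monoʳ-≤ x 0≤d)

  0≤+ : ∀ {x y} → 0ℤ ≤ x → 0ℤ ≤ y → 0ℤ ≤ x + y
  0≤+ = ℤ.+-mono-≤

  0≤* : ∀ {x y} → 0ℤ ≤ x → 0ℤ ≤ y → 0ℤ ≤ x * y
  0≤* {+ m} {+ n} _ _ = subst (0ℤ ≤_) (ℤ.pos-* m n) (+≤+ ℕ.z≤n)

  0≤pos : ∀ {n} → 0ℤ ≤ + n
  0≤pos = +≤+ ℕ.z≤n

  0≤- : ∀ {x y} → x ≤ y → 0ℤ ≤ y - x
  0≤- = ℤ.i≤j⇒0≤j-i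

  *-mono-≤-nonNeg : ∀ {w x y z} → 0ℤ ≤ w → 0ℤ ≤ y → w ≤ x → y ≤ z → w * y ≤ x * z
  *-mono-≤-nonNeg {w} {x} {y} {z} 0≤w 0≤y w≤x y≤z =
    ≤-byDifference ((x - w) * z + w * (z - y))
      (0≤+ (0≤* (0≤- w≤x) (ℤ.≤-trans 0≤y y≤z)) (0≤* 0≤w (0≤- y≤z)))
      (lemma w x y z)
    where
    lemma : ∀ w x y z → x * z ≡ w * y + ((x - w) * z + w * (z - y))
    lemma = solve-∀

  *-monoˡ-≤-0≤ : ∀ {x y z} → 0ℤ ≤ x → y ≤ z → x * y ≤ x * z
  *-monoˡ-≤-0≤ {x} {y} {z} 0≤x y≤z =
    ≤-byDifference (x * (z - y)) (0≤* 0≤x (0≤- y≤z)) (lemma x y z)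
    where
    lemma : ∀ x y z → x * z ≡ x * y + x * (z - y)
    lemma = solve-∀

  0≤square : ∀ x → 0ℤ ≤ x * x
  0≤square (+ n)      = 0≤* {+ n} {+ n} 0≤pos 0≤pos
  0≤square (-[1+ n ]) = +≤+ ℕ.z≤n

  square-≤ : ∀ {x y} → - y ≤ x → x ≤ y → x * x ≤ y * y
  square-≤ {x} {y} -y≤x x≤y = ≤-byDifference ((y - x) * (x - - y))
    (0≤* (0≤- x≤y) (0≤- -y≤x)) (lemma x y)
    where
    lemma : ∀ x y → y * y ≡ x * x + (y - x) * (x - - y)
    lemma = solve-∀

  square-cancel-≤ : ∀ {x y} → 0ℤ ≤ y → x * x ≤ y * y → x ≤ y
  square-cancel-≤ {x} {y} 0≤y x²≤y² with ℤ.≤-total x y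
  ... | inj₁ x≤y = x≤y
  ... | inj₂ y≤x with x ℤ.≟ y
  ...   | yes refl = ℤ.≤-refl
  ...   | no x≢y = ℤ.≮⇒≥ λ y<x → ℤ.<⇒≱ (strict y<x) x²≤y²
    where
    strict : y < x → y * y < x * x
    strict y<x = ℤ.≤-<-trans (*-monoˡ-≤-0≤ 0≤y (ℤ.<⇒≤ y<x))
      (ℤ.*-monoʳ-<-pos x {{Data.Integer.positive (ℤ.≤-<-trans 0≤y y<x)}} y<x)

  *-cancel-≤ : ∀ {x y z} → 0ℤ < x → x * y ≤ x * z → y ≤ z
  *-cancel-≤ {x} {y} {z} 0<x = ℤ.*-cancelˡ-≤-pos y z x {{Data.Integer.positive 0<x}}

  ⟦_⟧ : Bool → ℤ
  ⟦ true ⟧  = 1ℤ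
  ⟦ false ⟧ = 0ℤ

  0≤⟦_⟧ : ∀ b → 0ℤ ≤ ⟦ b ⟧
  0≤⟦ true ⟧  = 0≤pos
  0≤⟦ false ⟧ = 0≤pos

  ⟦_⟧≤1 : ∀ b → ⟦ b ⟧ ≤ 1ℤ
  ⟦ true ⟧≤1  = ℤ.≤-refl
  ⟦ false ⟧≤1 = 0≤pos

  ⟦∨⟧-≤ : ∀ x y → ⟦ x ∨ y ⟧ ≤ ⟦ x ⟧ + ⟦ y ⟧
  ⟦∨⟧-≤ true  true  = +≤+ (ℕ.s≤s ℕ.z≤n)
  ⟦∨⟧-≤ true  false = ℤ.≤-refl
  ⟦∨⟧-≤ false y     = ℤ.≤-reflexive (sym (ℤ.+-identityˡ ⟦ y ⟧))

  ∑-mono : ∀ {n} {f g : Fin n → ℤ} → (∀ i → f i ≤ g i) → sum f ≤ sum g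
  ∑-mono {ℕ.zero}  f≤g = ℤ.≤-refl
  ∑-mono {ℕ.suc n} f≤g = ℤ.+-mono-≤ (f≤g zero) (∑-mono (f≤g ∘ suc))

  0≤∑ : ∀ {n} {f : Fin n → ℤ} → (∀ i → 0ℤ ≤ f i) → 0ℤ ≤ sum f
  0≤∑ {ℕ.zero}  0≤f = ℤ.≤-refl
  0≤∑ {ℕ.suc n} 0≤f = 0≤+ (0≤f zero) (0≤∑ (0≤f ∘ suc))

  ∑-const : ∀ n x → ∑[ i < n ] x ≡ + n * x
  ∑-const ℕ.zero    x = sym (ℤ.*-zeroˡ x)
  ∑-const (ℕ.suc n) x = trans (cong (_+_ x) (∑-const n x)) (lemma (+ n) x)
    where
    lemma : ∀ n x → x + n * x ≡ (1ℤ + n) * x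
    lemma = solve-∀

  ∑-≤-const : ∀ {n} {f : Fin n → ℤ} {x} → (∀ i → f i ≤ x) → sum f ≤ + n * x
  ∑-≤-const {n} {f} {x} f≤x = subst (sum f ≤_) (∑-const n x) (∑-mono f≤x)

  ∑-neg : ∀ {n} (f : Fin n → ℤ) → ∑[ i < n ] (- f i) ≡ - sum f
  ∑-neg {ℕ.zero}  f = refl
  ∑-neg {ℕ.suc n} f = trans (cong (_+_ (- f zero)) (∑-neg (f ∘ suc)))
    (sym (ℤ.neg-distrib-+ (f zero) _))

  ∑-product : ∀ {m n} (f : Fin m → ℤ) (g : Fin n → ℤ) →
              sum f * sum g ≡ ∑[ i < m ] ∑[ j < n ] (f i * g j)
  ∑-product f g = trans (*-distribʳ-sum (sum g) f)
    (sum-cong-≗ λ i → *-distribˡ-sum (f i) g)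

  ∑-delta : ∀ {n} (j : Fin n) (f : Fin n → ℤ) →
            ∑[ i < n ] (⟦ does (j Fin.≟ i) ⟧ * f i) ≡ f j
  ∑-delta {ℕ.suc n} zero f = trans
    (cong₂ _+_ (ℤ.*-identityˡ (f zero)) (trans (∑-const n 0ℤ) (ℤ.*-zeroʳ (+ n))))
    (ℤ.+-identityʳ (f zero))
  ∑-delta {ℕ.suc n} (suc j) f = trans (ℤ.+-identityˡ _) (∑-delta j (f ∘ suc))

  ∑-fibres : ∀ {n s} (c : Fin n → Fin s) (f : Fin n → ℤ) →
             sum f ≡ ∑[ i < s ] ∑[ u < n ] (⟦ does (c u Fin.≟ i) ⟧ * f u)
  ∑-fibres c f = trans (sum-cong-≗ λ u → sym (∑-delta (c u) λ _ → f u))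
    (∑-comm λ u i → ⟦ does (c u Fin.≟ i) ⟧ * f u)

  -- A form of the Cauchy–Schwarz inequality, from ∑ᵢ∑ⱼ (zᵢ − zⱼ)² ≥ 0.
  square-∑-≤ : ∀ {n} (z : Fin n → ℤ) → sum z * sum z ≤ + n * ∑[ i < n ] (z i * z i)
  square-∑-≤ {n} z = *-cancel-≤ {+ 2} (+<+ ℕ.z<s)
    (≤-byDifference (∑[ i < n ] ∑[ j < n ] ((z i - z j) * (z i - z j)))
      (0≤∑ λ i → 0≤∑ λ j → 0≤square (z i - z j)) (sym eq))
    where
    S Q : ℤ
    S = sum z
    Q = ∑[ i < n ] (z i * z i)
    expand : ∀ x y → (x - y) * (x - y) ≡ (x * x + y * y) + (- + 2 * x) * y
    expand = solve-∀
    collect : ∀ n x S Q → (n * (x * x) + Q) + (- + 2 * x) * S ≡ (n * (x * x) + Q) + (- + 2 * S) * x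
    collect = solve-∀
    row : ∀ i → ∑[ j < n ] ((z i - z j) * (z i - z j)) ≡ (+ n * (z i * z i) + Q) + (- + 2 * S) * z i
    row i = trans (sum-cong-≗ λ j → expand (z i) (z j))
      (trans (∑-distrib-+ (λ j → z i * z i + z j * z j) λ j → (- + 2 * z i) * z j)
      (trans (cong₂ _+_ (trans (∑-distrib-+ (λ _ → z i * z i) λ j → z j * z j)
                               (cong (_+ Q) (∑-const n (z i * z i))))
                        (sym (*-distribˡ-sum (- + 2 * z i) z)))
             (collect (+ n) (z i) S Q)))
    final : ∀ n S Q → + 2 * (S * S) + ((n * Q + n * Q) + (- + 2 * S) * S) ≡ + 2 * (n * Q)
    final = solve-∀
    eq : + 2 * (S * S) + ∑[ i < n ] ∑[ j < n ] ((z i - z j) * (z i - z j)) ≡ + 2 * (+ n * Q)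
    eq = trans (cong (_+_ (+ 2 * (S * S)))
      (trans (sum-cong-≗ row)
      (trans (∑-distrib-+ (λ i → + n * (z i * z i) + Q) λ i → (- + 2 * S) * z i)
             (cong₂ _+_ (trans (∑-distrib-+ (λ i → + n * (z i * z i)) λ _ → Q)
                               (cong₂ _+_ (sym (*-distribˡ-sum (+ n) λ i → z i * z i)) (∑-const n Q)))
                        (sym (*-distribˡ-sum (- + 2 * S) z))))))
      (final (+ n) S Q)

  -- Balancing vectors by signs.

  sgn : Bool → ℤ → ℤ
  sgn true  x = - x
  sgn false x = x

  signedSum : ∀ {s m n} → (Fin s → Bool) → (Fin s → Fin m → Fin n → ℤ) → Fin m → Fin n → ℤ
  signedSum {s} σ w x y = ∑[ i < s ] sgn (σ i) (w i x y)

  squaredNorm : ∀ {m n} → (Fin m → Fin n → ℤ) → ℤ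
  squaredNorm {m} {n} f = ∑[ x < m ] ∑[ y < n ] (f x y * f x y)

  squaredNorm-cong : ∀ {l m} {f g : Fin l → Fin m → ℤ} → (∀ x y → f x y ≡ g x y) → squaredNorm f ≡ squaredNorm g
  squaredNorm-cong eq = sum-cong-≗ λ x → sum-cong-≗ λ y → cong (λ z → z * z) (eq x y)

  -- Signs are chosen one at a time, so that each new vector has nonpositive
  -- inner product with the signed sum of the earlier ones.
  balance : ∀ {s m n} (w : Fin s → Fin m → Fin n → ℤ) →
            ∃[ σ ] squaredNorm (signedSum σ w) ≤ ∑[ i < s ] squaredNorm (w i)
  balance {ℕ.zero} {m} {n} w = (λ ()) , ℤ.≤-reflexive
    (trans (sum-cong-≗ {m} λ _ → trans (∑-const n 0ℤ) (ℤ.*-zeroʳ (+ n)))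
           (trans (∑-const m 0ℤ) (ℤ.*-zeroʳ (+ m))))
  balance {ℕ.suc s} {m} {n} w = extend (balance (w ∘ suc))
    where
    Goal : Set
    Goal = ∃[ σ ] squaredNorm (signedSum σ w) ≤ ∑[ i < ℕ.suc s ] squaredNorm (w i)
    extend : (∃[ σ ] squaredNorm (signedSum σ (w ∘ suc)) ≤ ∑[ i < s ] squaredNorm (w (suc i))) → Goal
    extend (σ , bound) = choose (ℤ.≤-total inner 0ℤ)
      where
      S W : Fin m → Fin n → ℤ
      S = signedSum σ (w ∘ suc)
      W x y = w zero x y
      inner SS WW : ℤ
      inner = ∑[ x < m ] ∑[ y < n ] (W x y * S x y)
      SS = squaredNorm S
      WW = squaredNorm W
      sums : ∀ a (f : Fin m → Fin n → ℤ) →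
        (∀ x y → f x y ≡ W x y * W x y + (S x y * S x y + a * (W x y * S x y))) →
        ∑[ x < m ] ∑[ y < n ] f x y ≡ WW + (SS + a * inner)
      sums a f eq =
        trans (sum-cong-≗ λ x →
          trans (sum-cong-≗ (eq x))
          (trans (∑-distrib-+ (λ y → W x y * W x y) λ y → S x y * S x y + a * (W x y * S x y))
          (cong (_+_ (∑[ y < n ] (W x y * W x y)))
            (trans (∑-distrib-+ (λ y → S x y * S x y) λ y → a * (W x y * S x y))
                   (cong (_+_ (∑[ y < n ] (S x y * S x y)))
                     (sym (*-distribˡ-sum a λ y → W x y * S x y)))))))
        (trans (∑-distrib-+ (λ x → ∑[ y < n ] (W x y * W x y)) _)
        (cong (_+_ WW)
          (trans (∑-distrib-+ (λ x → ∑[ y < n ] (S x y * S x y)) _)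
                 (cong (_+_ SS) (sym (*-distribˡ-sum a λ x → ∑[ y < n ] (W x y * S x y)))))))
      conclude : ∀ a {f : Fin m → Fin n → ℤ} →
        (∀ x y → f x y ≡ W x y * W x y + (S x y * S x y + a * (W x y * S x y))) →
        0ℤ ≤ - (a * inner) →
        ∑[ x < m ] ∑[ y < n ] f x y ≤ WW + ∑[ i < s ] squaredNorm (w (suc i))
      conclude a {f} eq 0≤ = subst (_≤ _) (sym (sums a f eq))
        (ℤ.+-monoʳ-≤ WW (ℤ.≤-trans (≤-byDifference (- (a * inner)) 0≤ (cancel SS (a * inner))) bound))
        where
        cancel : ∀ x y → x ≡ (x + y) + - y
        cancel = solve-∀
      plus : ∀ x y → (x + y) * (x + y) ≡ x * x + (y * y + + 2 * (x * y))
      plus = solve-∀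
      minus : ∀ x y → (- x + y) * (- x + y) ≡ x * x + (y * y + - + 2 * (x * y))
      minus = solve-∀
      choose : inner ≤ 0ℤ ⊎ 0ℤ ≤ inner → Goal
      choose (inj₁ inner≤0) = (λ { zero → false ; (suc i) → σ i }) ,
        conclude (+ 2) (λ x y → plus (W x y) (S x y))
          (subst (0ℤ ≤_) (negate inner) (0≤* (0≤pos {2}) (0≤- inner≤0)))
        where
        negate : ∀ x → + 2 * (0ℤ - x) ≡ - (+ 2 * x)
        negate = solve-∀
      choose (inj₂ 0≤inner) = (λ { zero → true ; (suc i) → σ i }) ,
        conclude (- + 2) (λ x y → minus (W x y) (S x y))
          (subst (0ℤ ≤_) (negate inner) (0≤* (0≤pos {2}) 0≤inner))
        where
        negate : ∀ x → + 2 * x ≡ - (- + 2 * x)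
        negate = solve-∀

-- Reversal patterns realised by inversions.

module Inversions where

  open import Data.Nat using (zero; suc; _+_; _*_; _∸_; _≤_; _<_; z≤n; s≤s; s≤s⁻¹; _≤?_; _<?_; _≟_; NonZero; >-nonZero; z<s)

  does-∈? : ∀ {n} (X : Subset n) u → does (u ∈? X) ≡ lookup X u
  does-∈? (true  ∷ X) zero    = refl
  does-∈? (false ∷ X) zero    = refl
  does-∈? (_     ∷ X) (suc u) = does-∈? X u

  does-∈?-tabulate : ∀ {n} (a : Fin n → Bool) u → does (u ∈? tabulate a) ≡ a u
  does-∈?-tabulate a u = trans (does-∈? (tabulate a) u) (lookup∘tabulate a u)

  reverseOn : ∀ {n} → (Fin n → Fin n → Bool) → Digraph (Fin n) → Digraph (Fin n)
  reverseOn φ D u v = if φ u v then D v u else D u v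

  between : ∀ {n} → (Fin n → Bool) → (Fin n → Bool) → Fin n → Fin n → Bool
  between a b u v = (a u ∧ b v) xor (b u ∧ a v)

  -- Over 𝔽₂, a ⊗ b + b ⊗ a = (a + b) ⊗ (a + b) + a ⊗ a + b ⊗ b.
  reverseBetween : ∀ {n} → (Fin n → Bool) → (Fin n → Bool) → List (Subset n)
  reverseBetween a b = tabulate (λ u → a u xor b u) ∷ tabulate a ∷ tabulate b ∷ []

  invertAll-reverseBetween : ∀ {n} (D : Digraph (Fin n)) a b u v →
    invertAll D (reverseBetween a b) u v ≡ reverseOn (between a b) D u v
  invertAll-reverseBetween D a b u v
    rewrite does-∈?-tabulate a u | does-∈?-tabulate a v
          | does-∈?-tabulate b u | does-∈?-tabulate b v
          | does-∈?-tabulate (λ u → a u xor b u) u | does-∈?-tabulate (λ u → a u xor b u) v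
    with a u | a v | b u | b v
  ... | true  | true  | true  | true  = refl
  ... | true  | true  | true  | false = refl
  ... | true  | true  | false | true  = refl
  ... | true  | true  | false | false = refl
  ... | true  | false | true  | true  = refl
  ... | true  | false | true  | false = refl
  ... | true  | false | false | true  = refl
  ... | true  | false | false | false = refl
  ... | false | true  | true  | true  = refl
  ... | false | true  | true  | false = refl
  ... | false | true  | false | true  = refl
  ... | false | true  | false | false = refl
  ... | false | false | true  | true  = refl
  ... | false | false | true  | false = refl
  ... | false | false | false | true  = refl
  ... | false | false | false | false = refl

  invertAll-++ : ∀ {n} (D : Digraph (Fin n)) Xs Ys →
                 invertAll D (Xs ++ Ys) ≡ invertAll (invertAll D Xs) Ys
  invertAll-++ D Xs Ys = foldl-++ invert D Xs Ys

  invert-isTournament : ∀ {n} {D : Digraph (Fin n)} X → IsTournament D → IsTournament (invert D X)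
  invert-isTournament {D = D} X t = record { loopless = loop ; oriented = orient }
    where
    open IsTournament t
    loop : ∀ v → invert D X v v ≡ false
    loop v with does (v ∈? X)
    ... | true  = loopless v
    ... | false = loopless v
    orient : ∀ {u v} → u ≢ v → invert D X u v ≡ not (invert D X v u)
    orient {u} {v} u≢v with does (u ∈? X) | does (v ∈? X)
    ... | true  | true  = oriented (u≢v ∘ sym)
    ... | true  | false = oriented u≢v
    ... | false | true  = oriented u≢v
    ... | false | false = oriented u≢v

  invertAll-isTournament : ∀ {n} {D : Digraph (Fin n)} Xs → IsTournament D → IsTournament (invertAll D Xs)
  invertAll-isTournament []       t = t
  invertAll-isTournament (X ∷ Xs) t = invertAll-isTournament Xs (invert-isTournament X t)

  -- Stage t reverses the arcs between colour class t and a set of vertices of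
  -- smaller colours, so it leaves all pairs alone whose larger colour is not t.
  module _ {n : ℕ} (c : Fin n → ℕ) where

    class : ℕ → Fin n → Bool
    class t v = does (c v ≟ t)

    below : ℕ → (Fin n → Bool) → Fin n → Bool
    below t a v = does (c v <? t) ∧ a v

    reverseClass : ℕ → (Fin n → Bool) → Digraph (Fin n) → Digraph (Fin n)
    reverseClass t a = reverseOn (between (class t) (below t a))

    reverseClass-< : ∀ D {t a u v} → c u < t → c v < t → reverseClass t a D u v ≡ D u v
    reverseClass-< D {t} {a} {u} {v} u<t v<t
      rewrite dec-false (c u ≟ t) (ℕ.<⇒≢ u<t) | dec-false (c v ≟ t) (ℕ.<⇒≢ v<t)
      with below t a u
    ... | true  = refl
    ... | false = refl

    reverseClass-> : ∀ D {t a u v} → t < c v →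
                     reverseClass t a D u v ≡ D u v × reverseClass t a D v u ≡ D v u
    reverseClass-> D {t} {a} {u} {v} t<v
      rewrite dec-false (c v ≟ t) (ℕ.<⇒≢ t<v ∘ sym) | dec-false (c v <? t) (ℕ.<⇒≯ t<v)
      with class t u | below t a u
    ... | true  | true  = refl , refl
    ... | true  | false = refl , refl
    ... | false | true  = refl , refl
    ... | false | false = refl , refl

    reverseClass-≡ : ∀ D {t a u v} → c v ≡ t →
      reverseClass t a D u v ≡ (if below t a u then D v u else D u v) ×
      reverseClass t a D v u ≡ (if below t a u then D u v else D v u)
    reverseClass-≡ D {t} {a} {u} {v} refl
      rewrite dec-true (c v ≟ c v) refl | dec-false (c v <? c v) (ℕ.<-irrefl refl)
      with class (c v) u | below (c v) a u
    ... | true  | true  = refl , refl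
    ... | true  | false = refl , refl
    ... | false | true  = refl , refl
    ... | false | false = refl , refl

    AgreesFrom : ℕ → Digraph (Fin n) → Digraph (Fin n) → Set
    AgreesFrom t D D′ = ∀ u v → t ≤ c v → D u v ≡ D′ u v × D v u ≡ D′ v u

    module _ (Q : ℕ → Digraph (Fin n) → Set)
      (local : ∀ {t D D′} → (∀ u v → c u ≤ t → c v ≤ t → D u v ≡ D′ u v) → Q t D → Q t D′)
      (T₀ : Digraph (Fin n))
      (step : ∀ t D → AgreesFrom t D T₀ →
              ∃[ a ] (∀ D′ → (∀ u v → D′ u v ≡ reverseClass t a D u v) → Q t D′))
      where

      -- The set used at stage t may depend on the digraph produced so far, which is what a greedy
      -- choice requires. `local` carries `Q t` through the later stages, because these change only
      -- pairs whose larger colour exceeds t.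
      colourByColour : ∀ s → ∃[ Xs ] (length Xs ≡ s * 3 × (∀ t → t < s → Q t (invertAll T₀ Xs)) ×
                                      AgreesFrom s (invertAll T₀ Xs) T₀)
      colourByColour zero = [] , refl , (λ _ ()) , λ _ _ _ → refl , refl
      colourByColour (suc s) = Xs ++ Ys ,
        trans (length-++ Xs) (trans (cong (_+ 3) len) (ℕ.+-comm (s * 3) 3)) ,
        (λ t t<1+s → subst (Q t) (sym (invertAll-++ T₀ Xs Ys)) (new t (ℕ.m≤n⇒m<n∨m≡n (s≤s⁻¹ t<1+s)))) ,
        subst (λ D → AgreesFrom (suc s) D T₀) (sym (invertAll-++ T₀ Xs Ys)) λ u v s<v →
          trans (described u v) (trans (proj₁ (reverseClass-> D {u = u} s<v)) (proj₁ (agrees u v (ℕ.<⇒≤ s<v)))) ,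
          trans (described v u) (trans (proj₂ (reverseClass-> D {u = u} s<v)) (proj₂ (agrees u v (ℕ.<⇒≤ s<v))))
        where
        previous = colourByColour s
        Xs = proj₁ previous
        len = proj₁ (proj₂ previous)
        qs = proj₁ (proj₂ (proj₂ previous))
        agrees = proj₂ (proj₂ (proj₂ previous))
        D = invertAll T₀ Xs
        a = proj₁ (step s D agrees)
        Ys = reverseBetween (class s) (below s a)
        described = invertAll-reverseBetween D (class s) (below s a)
        new : ∀ t → t < s ⊎ t ≡ s → Q t (invertAll D Ys)
        new t (inj₁ t<s) = local (λ u v u≤t v≤t → sym (trans (described u v)
          (reverseClass-< D (ℕ.≤-<-trans u≤t t<s) (ℕ.≤-<-trans v≤t t<s)))) (qs t t<s)
        new t (inj₂ refl) = proj₂ (step s D agrees) _ described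

    -- The non-adaptive case. A colour costs three inversions however complicated the set of lower
    -- vertices reversed against it, so `φ` can be prescribed vertex by vertex.
    reverseClasses : (T₀ : Digraph (Fin n)) (φ : ℕ → Fin n → Bool) (s : ℕ) → (∀ v → c v < s) →
      ∃[ Xs ] (length Xs ≡ s * 3 × (∀ u v → c u ≤ c v →
        invertAll T₀ Xs u v ≡ (if does (c u <? c v) ∧ φ (c v) u then T₀ v u else T₀ u v)))
    reverseClasses T₀ φ s c<s =
      let Xs , len , qs , _ = colourByColour Q local T₀ step s
      in Xs , len , λ u v u≤v → qs (c v) (c<s v) u v refl u≤v
      where
      Q : ℕ → Digraph (Fin n) → Set
      Q t D = ∀ u v → c v ≡ t → c u ≤ t → D u v ≡ (if does (c u <? t) ∧ φ t u then T₀ v u else T₀ u v)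
      local : ∀ {t D D′} → (∀ u v → c u ≤ t → c v ≤ t → D u v ≡ D′ u v) → Q t D → Q t D′
      local same q u v v≡t u≤t = trans (sym (same u v u≤t (ℕ.≤-reflexive v≡t))) (q u v v≡t u≤t)
      step : ∀ t D → AgreesFrom t D T₀ →
             ∃[ a ] (∀ D′ → (∀ u v → D′ u v ≡ reverseClass t a D u v) → Q t D′)
      step t D agrees = φ t , λ D′ described u v v≡t u≤t →
        trans (described u v) (trans (proj₁ (reverseClass-≡ D v≡t))
          (cong₂ (if does (c u <? t) ∧ φ t u then_else_)
            (proj₂ (agrees u v (ℕ.≤-reflexive (sym v≡t)))) (proj₁ (agrees u v (ℕ.≤-reflexive (sym v≡t))))))

  -- Reachability, decidability of being k-strong, and existence of the minimum.

  Closed : ∀ {n} → Digraph (Fin n) → Subset n → Set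
  Closed E R = ∀ {v w} → v ∈ R → Arc E v w → w ∈ R

  -- Besides deciding reachability, this produces cuts: if some vertex is missing from the closed
  -- set, no arc leads from the set to its complement.
  reachableSet : ∀ {n} (E : Digraph (Fin n)) u →
    ∃[ R ] (u ∈ R × (∀ {v} → v ∈ R → Star (Arc E) u v) × Closed E R)
  reachableSet {n} E u = grow ⁅ u ⁆ (⊃-wellFounded _) (x∈⁅x⁆ u)
    λ v∈u → subst (Star (Arc E) u) (sym (x∈⁅y⁆⇒x≡y u v∈u)) ε
    where
    grow : ∀ R → Acc _⊃_ R → u ∈ R → (∀ {v} → v ∈ R → Star (Arc E) u v) →
      ∃[ R ] (u ∈ R × (∀ {v} → v ∈ R → Star (Arc E) u v) × Closed E R)
    grow R (acc larger) u∈R reach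
      with Fin.any? (λ v → Fin.any? (λ w → v ∈? R ×-dec T? (E v w) ×-dec ¬? (w ∈? R)))
    ... | no none = R , u∈R , reach , λ {v} {w} v∈R arc →
      decidable-stable (w ∈? R) λ w∉R → none (v , w , v∈R , arc , w∉R)
    ... | yes (v , w , v∈R , arc , w∉R) = grow (R ∪ ⁅ w ⁆)
      (larger (p⊆p∪q ⁅ w ⁆ , w , x∈p∪q⁺ (inj₂ (x∈⁅x⁆ w)) , w∉R))
      (x∈p∪q⁺ (inj₁ u∈R))
      λ x∈ → [ reach , (λ x∈w → subst (Star (Arc E) u) (sym (x∈⁅y⁆⇒x≡y w x∈w)) (reach v∈R ◅◅ arc ◅ ε)) ]′
               (x∈p∪q⁻ R ⁅ w ⁆ x∈)

  closed-star : ∀ {n} {E : Digraph (Fin n)} {R u v} → Closed E R → u ∈ R → Star (Arc E) u v → v ∈ R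
  closed-star closed u∈R ε            = u∈R
  closed-star closed u∈R (arc ◅ path) = closed-star closed (closed u∈R arc) path

  star? : ∀ {n} (E : Digraph (Fin n)) u v → Dec (Star (Arc E) u v)
  star? E u v = decide (reachableSet E u)
    where
    decide : ∃[ R ] (u ∈ R × (∀ {v} → v ∈ R → Star (Arc E) u v) × Closed E R) → Dec (Star (Arc E) u v)
    decide (R , u∈R , reach , closed) = map′ reach (closed-star closed u∈R) (v ∈? R)

  module _ {n : ℕ} (D : Digraph (Fin n)) (S : Subset n) where

    -- Only the head of an arc is tested. A path that starts outside `S` therefore stays outside
    -- `S`, and its start is supplied separately when it is moved to `D − S`.
    into : (Fin n → Bool) → Digraph (Fin n)
    into ok u v = D u v ∧ ok v

    liftStar : ∀ {ok} → (∀ {v} → T (ok v) → v ∉ S) → ∀ {u v} .(u∉S : u ∉ S) .(v∉S : v ∉ S) →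
               Star (Arc (into ok)) u v → Star (Arc (D − S)) (u , [ u∉S ]) (v , [ v∉S ])
    liftStar ok⇒∉ u∉S v∉S ε = ε
    liftStar ok⇒∉ u∉S v∉S (arc ◅ path) =
      let arcD , okw = Equivalence.to T-∧ arc in arcD ◅ liftStar ok⇒∉ (ok⇒∉ okw) v∉S path

    outside? : Fin n → Bool
    outside? v = does (¬? (v ∈? S))

    lowerStar : ∀ {u v} → Star (Arc (D − S)) u v → Star (Arc (into outside?)) (value u) (value v)
    lowerStar ε = ε
    lowerStar {u} (_◅_ {j = w , [ w∉S ]} arc path) = Equivalence.from T-∧ (arc , ok) ◅ lowerStar path
      where
      ok : T (outside? w)
      ok rewrite dec-true (¬? (w ∈? S)) (recompute (¬? (w ∈? S)) w∉S) = _

    outside?⇒∉ : ∀ {v} → T (outside? v) → v ∉ S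
    outside?⇒∉ {v} ok with v ∈? S
    ... | no v∉S = v∉S

    stronglyConnected? : Dec (StronglyConnected (D − S))
    stronglyConnected? = map′
      (λ paths (u , [ u∉S ]) (v , [ v∉S ]) → liftStar outside?⇒∉ u∉S v∉S
        (paths u v (recompute (¬? (u ∈? S)) u∉S) (recompute (¬? (v ∈? S)) v∉S)))
      (λ strong u v u∉S v∉S → lowerStar (strong (u , [ u∉S ]) (v , [ v∉S ])))
      (Fin.all? λ u → Fin.all? λ v → ¬? (u ∈? S) →-dec ¬? (v ∈? S) →-dec star? (into outside?) u v)

  isStrong? : ∀ {n} k (D : Digraph (Fin n)) → Dec (IsStrong k D)
  isStrong? {n} k D = (k + 1 ≤? n) ×-dec map′
    (λ none S S<k → decidable-stable (stronglyConnected? D S) λ ¬strong → none (S , S<k , ¬strong))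
    (λ strong (S , S<k , ¬strong) → ¬strong (strong S S<k))
    (¬? (anySubset? λ S → (∣ S ∣ <? k) ×-dec ¬? (stronglyConnected? D S)))

  StrongAfter : ∀ {n} → ℕ → Digraph (Fin n) → ℕ → Set
  StrongAfter k D m = ∃[ Xs ] (length Xs ≡ m × IsStrong k (invertAll D Xs))

  strongAfter? : ∀ {n} k (D : Digraph (Fin n)) m → Dec (StrongAfter k D m)
  strongAfter? k D zero = map′ (λ strong → [] , refl , strong) (λ { ([] , _ , strong) → strong }) (isStrong? k D)
  strongAfter? k D (suc m) = map′
    (λ (X , Xs , len , strong) → X ∷ Xs , cong suc len , strong)
    (λ { (X ∷ Xs , len , strong) → X , Xs , ℕ.suc-injective len , strong })
    (anySubset? λ X → strongAfter? k (invert D X) m)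

  least : ∀ {P : ℕ → Set} → (∀ m → Dec (P m)) → ∀ m → P m → ∃[ l ] (P l × l ≤ m × (∀ j → P j → l ≤ j))
  least P? zero p = zero , p , z≤n , λ _ _ → z≤n
  least {P} P? (suc m) p with P? zero
  ... | yes p₀ = zero , p₀ , z≤n , λ _ _ → z≤n
  ... | no ¬p₀ = let l , pl , l≤m , minimal = least (P? ∘ suc) m p in
    suc l , pl , s≤s l≤m , λ { zero p₀ → ⊥-elim (¬p₀ p₀) ; (suc j) pj → s≤s (minimal j pj) }

  -- There are finitely many lists of subsets of each length and being k-strong is decidable, so the
  -- least length can be found by search below a known one.
  sinv-≤ : ∀ {n} k (D : Digraph (Fin n)) Xs → IsStrong k (invertAll D Xs) →
           ∃[ m ] (IsSinv k D m × m ≤ length Xs)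
  sinv-≤ k D Xs strong = let m , attained , m≤ , minimal = least (strongAfter? k D) (length Xs) (Xs , refl , strong) in
    m , record { attained = attained ; minimal = λ Ys strongYs → minimal (length Ys) (Ys , refl , strongYs) } , m≤

  -- Circular tournaments, for bounded n.

  injective⇒≤∣S∣ : ∀ {k n} (S : Subset n) (f : Fin k → Fin n) → (∀ {i j} → f i ≡ f j → i ≡ j) →
                   (∀ i → f i ∈ S) → k ≤ ∣ S ∣
  injective⇒≤∣S∣ {zero}  S f inj f∈S = z≤n
  injective⇒≤∣S∣ {suc k} S f inj f∈S = ℕ.≤-<-trans
    (injective⇒≤∣S∣ (S ∖ f zero) (f ∘ suc) (Fin.suc-injective ∘ inj)
      λ i → x∈p∧x≢y⇒x∈p-y (f∈S (suc i)) λ eq → Fin.0≢1+n (sym (inj eq)))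
    (x∈p⇒∣p-x∣<∣p∣ (f∈S zero))

  outside?⁺ : ∀ {n} (D : Digraph (Fin n)) S {v} → v ∉ S → T (outside? D S v)
  outside?⁺ D S {v} v∉S rewrite dec-true (¬? (v ∈? S)) v∉S = _

  module _ {n : ℕ} .{{_ : NonZero n}} (k : ℕ) (2k<n : 2 * k < n) (D : Digraph (Fin n)) where

    residue : ℕ → Fin n
    residue x = fromℕ< (m%n<n x n)

    k<n : k < n
    k<n = ℕ.≤-<-trans (ℕ.m≤m+n k (k + 0)) 2k<n

    residue-+ : ∀ x {j} → j < n →
      toℕ (residue (x + j)) ≡ toℕ (residue x) + j ⊎ toℕ (residue (x + j)) + n ≡ toℕ (residue x) + j
    residue-+ x {j} j<n = subst₂ (λ y z → y ≡ z + j ⊎ y + n ≡ z + j)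
      (trans (sym reduce) (sym (Fin.toℕ-fromℕ< (m%n<n (x + j) n)))) (sym (Fin.toℕ-fromℕ< (m%n<n x n))) cases
      where
      reduce : (x + j) % n ≡ (x % n + j) % n
      reduce = trans (%-distribˡ-+ x j n) (cong (λ y → (x % n + y) % n) (m<n⇒m%n≡m j<n))
      cases : (x % n + j) % n ≡ x % n + j ⊎ (x % n + j) % n + n ≡ x % n + j
      cases with x % n + j <? n
      ... | yes small = inj₁ (m<n⇒m%n≡m small)
      ... | no  large = inj₂ (trans (cong (_+ n) (trans (sym (m≤n⇒[n∸m]%m≡n%m n≤)) (m<n⇒m%n≡m smaller)))
                                    (ℕ.m∸n+n≡m n≤))
        where
        n≤ = ℕ.≮⇒≥ large
        smaller : x % n + j ∸ n < n
        smaller = ℕ.+-cancelʳ-< n _ n (subst (_< n + n) (sym (ℕ.m∸n+n≡m n≤)) (ℕ.+-mono-< (m%n<n x n) j<n))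

    residue-injective : ∀ x {i j} → i < n → j < n → residue (x + i) ≡ residue (x + j) → i ≡ j
    residue-injective x {i} {j} i<n j<n eq with residue-+ x i<n | residue-+ x j<n
    ... | inj₁ p | inj₁ q = ℕ.+-cancelˡ-≡ r i j (trans (sym p) (trans (cong toℕ eq) q))
      where r = toℕ (residue x)
    ... | inj₂ p | inj₂ q = ℕ.+-cancelˡ-≡ r i j (trans (sym p) (trans (cong (λ w → toℕ w + n) eq) q))
      where r = toℕ (residue x)
    ... | inj₁ p | inj₂ q = ⊥-elim (ℕ.<-irrefl (ℕ.+-cancelˡ-≡ r j (i + n)
        (trans (sym q) (trans (cong (λ w → toℕ w + n) (sym eq)) (trans (cong (_+ n) p) (ℕ.+-assoc r i n)))))
        (ℕ.<-≤-trans j<n (ℕ.m≤n+m n i)))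
      where r = toℕ (residue x)
    ... | inj₂ p | inj₁ q = ⊥-elim (ℕ.<-irrefl (ℕ.+-cancelˡ-≡ r i (j + n)
        (trans (sym p) (trans (cong (λ w → toℕ w + n) eq) (trans (cong (_+ n) q) (ℕ.+-assoc r j n)))))
        (ℕ.<-≤-trans i<n (ℕ.m≤n+m n j)))
      where r = toℕ (residue x)

    residue-toℕ : ∀ v → residue (toℕ v) ≡ v
    residue-toℕ v = Fin.toℕ-injective (trans (Fin.toℕ-fromℕ< _) (m<n⇒m%n≡m (Fin.toℕ<n v)))

    residue-+n : ∀ v → residue (toℕ v + n) ≡ v
    residue-+n v = Fin.toℕ-injective (trans (Fin.toℕ-fromℕ< _)
      (trans ([m+n]%n≡m%n (toℕ v) n) (m<n⇒m%n≡m (Fin.toℕ<n v))))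

    module _ (forward  : ∀ u v → toℕ u < toℕ v → toℕ v ≤ toℕ u + k → Arc D u v)
             (backward : ∀ u v → toℕ v < toℕ u → toℕ v + n ≤ toℕ u + k → Arc D u v) where

      residue-arc : ∀ x {j} → 0 < j → j ≤ k → Arc D (residue x) (residue (x + j))
      residue-arc x {j} 0<j j≤k with residue-+ x (ℕ.≤-<-trans j≤k k<n)
      ... | inj₁ eq = forward _ _
        (subst (r <_) (sym eq) (ℕ.m<m+n r 0<j))
        (subst (_≤ r + k) (sym eq) (ℕ.+-monoʳ-≤ r j≤k))
        where r = toℕ (residue x)
      ... | inj₂ eq = backward _ _
        (ℕ.+-cancelʳ-< n _ r (subst (_< r + n) (sym eq) (ℕ.+-monoʳ-< r (ℕ.≤-<-trans j≤k k<n))))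
        (subst (_≤ r + k) (sym eq) (ℕ.+-monoʳ-≤ r j≤k))
        where r = toℕ (residue x)

      module _ (S : Subset n) (S<k : ∣ S ∣ < k) where

        survivor : ∀ x → ∃[ j ] (0 < j × j ≤ k × residue (x + j) ∉ S)
        survivor x with Fin.any? (λ (i : Fin k) → ¬? (residue (x + suc (toℕ i)) ∈? S))
        ... | yes (i , ∉S) = suc (toℕ i) , z<s , Fin.toℕ<n i , ∉S
        ... | no none = ⊥-elim (ℕ.<⇒≱ S<k (injective⇒≤∣S∣ S (λ (i : Fin k) → residue (x + suc (toℕ i)))
          (λ {i} {j} eq → Fin.toℕ-injective (ℕ.suc-injective
            (residue-injective x (ℕ.≤-<-trans (Fin.toℕ<n i) k<n) (ℕ.≤-<-trans (Fin.toℕ<n j) k<n) eq)))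
          λ i → decidable-stable (residue (x + suc (toℕ i)) ∈? S) λ ∉S → none (i , ∉S)))

        -- While the target is more than k ahead, jump to a survivor among the next k vertices,
        -- which cannot all be deleted; the jump never overshoots. Within distance k a single arc
        -- finishes.
        walk : ∀ fuel x d → d ≤ fuel → residue (x + d) ∉ S →
               Star (Arc (into D S (outside? D S))) (residue x) (residue (x + d))
        walk fuel x zero d≤ ∉S = subst (λ y → Star (Arc (into D S (outside? D S))) (residue x) (residue y)) (sym (ℕ.+-identityʳ x)) ε
        walk (suc fuel) x d@(suc _) d≤ ∉S with d ≤? k
        ... | yes d≤k = Equivalence.from T-∧ (residue-arc x z<s d≤k , outside?⁺ D S ∉S) ◅ ε
        ... | no  d≰k = go (survivor x)
          where
          go : ∃[ j ] (0 < j × j ≤ k × residue (x + j) ∉ S) → _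
          go (j , 0<j , j≤k , j∉S) = Equivalence.from T-∧ (residue-arc x 0<j j≤k , outside?⁺ D S j∉S)
            ◅ subst (λ y → Star (Arc (into D S (outside? D S))) (residue (x + j)) (residue y)) eq
                (walk fuel (x + j) (d ∸ j) (s≤s⁻¹ (ℕ.<-≤-trans (ℕ.∸-monoʳ-< 0<j j≤d) d≤))
                  (subst (λ y → residue y ∉ S) (sym eq) ∉S))
            where
            j≤d : j ≤ d
            j≤d = ℕ.≤-trans j≤k (ℕ.<⇒≤ (ℕ.≰⇒> d≰k))
            eq : x + j + (d ∸ j) ≡ x + d
            eq = trans (ℕ.+-assoc x j (d ∸ j)) (cong (x +_) (ℕ.m+[n∸m]≡n j≤d))

      circular⇒isStrong : IsStrong k D
      circular⇒isStrong = subst (_≤ n) (ℕ.+-comm 1 k) k<n , λ S S<k (u , [ u∉S ]) (v , [ v∉S ]) →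
        liftStar D S (outside?⇒∉ D S) u∉S v∉S
          (path S S<k u v (recompute (¬? (v ∈? S)) v∉S))
        where
        path : ∀ S → ∣ S ∣ < k → ∀ u v → v ∉ S → Star (Arc (into D S (outside? D S))) u v
        path S S<k u v v∉S = subst₂ (Star _) (residue-toℕ u) target
          -- The extra n keeps the subtraction from truncating when v precedes u; it does not change
          -- the residue of the target.
          (walk S S<k _ (toℕ u) (toℕ v + n ∸ toℕ u) ℕ.≤-refl (subst (_∉ S) (sym target) v∉S))
          where
          target : residue (toℕ u + (toℕ v + n ∸ toℕ u)) ≡ v
          target = trans (cong residue (ℕ.m+[n∸m]≡n
            (ℕ.≤-trans (ℕ.<⇒≤ (Fin.toℕ<n u)) (ℕ.m≤n+m n (toℕ v))))) (residue-+n v)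

  -- Every vertex is its own colour, so any tournament on the same vertices can be reached with
  -- three inversions per vertex.
  strongByLinearlyMany : ∀ {n} k → 2 * k < n → (T₀ : Digraph (Fin n)) → IsTournament T₀ →
                         ∃[ Xs ] (length Xs ≡ n * 3 × IsStrong k (invertAll T₀ Xs))
  strongByLinearlyMany {n} k 2k<n T₀ tour = Xs , proj₁ (proj₂ reversed) ,
    circular⇒isStrong {{>-nonZero (ℕ.≤-<-trans z≤n 2k<n)}} k 2k<n D forward backward
    where
    -- For u below t the arc u → t is prescribed unless u + n ≤ t + k, that is, unless u is among
    -- the k vertices that follow t around the circle. This does not clash with t ≤ u + k, since
    -- together they would give n ≤ 2 k.
    target : ℕ → Fin n → Bool
    target t u = does (t + k <? n + toℕ u)
    φ : ℕ → Fin n → Bool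
    φ t u with t <? n
    ... | yes t<n = T₀ u (fromℕ< t<n) xor target t u
    ... | no  _   = false
    φ-toℕ : ∀ v u → φ (toℕ v) u ≡ T₀ u v xor target (toℕ v) u
    φ-toℕ v u with toℕ v <? n
    ... | yes v<n = cong (λ w → T₀ u w xor target (toℕ v) u) (Fin.fromℕ<-toℕ v v<n)
    ... | no  v≮n = ⊥-elim (v≮n (Fin.toℕ<n v))
    choose : ∀ x y b → y ≡ not x → (if x xor b then y else x) ≡ b
    choose true  y true  eq = refl
    choose true  y false eq = eq
    choose false y true  eq = eq
    choose false y false eq = refl
    reversed = reverseClasses toℕ T₀ φ n Fin.toℕ<n
    Xs = proj₁ reversed
    described = proj₂ (proj₂ reversed)
    D = invertAll T₀ Xs
    open IsTournament (invertAll-isTournament Xs tour)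
    D-< : ∀ u v → toℕ u < toℕ v → D u v ≡ target (toℕ v) u
    D-< u v u<v = trans (described u v (ℕ.<⇒≤ u<v))
      (trans (cong₂ (λ b b′ → if b ∧ b′ then T₀ v u else T₀ u v) (dec-true (toℕ u <? toℕ v) u<v) (φ-toℕ v u))
      (choose (T₀ u v) (T₀ v u) _ (IsTournament.oriented tour λ eq → ℕ.<-irrefl (cong toℕ (sym eq)) u<v)))
    forward : ∀ u v → toℕ u < toℕ v → toℕ v ≤ toℕ u + k → Arc D u v
    forward u v u<v v≤u+k = subst T (sym (trans (D-< u v u<v) (dec-true (toℕ v + k <? n + toℕ u) bound))) _
      where
      bound : toℕ v + k < n + toℕ u
      bound = ℕ.≤-<-trans (ℕ.+-monoˡ-≤ k v≤u+k)
        (subst₂ _<_ (trans (cong (toℕ u +_) (cong (k +_) (ℕ.+-identityʳ k))) (sym (ℕ.+-assoc (toℕ u) k k)))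
          (ℕ.+-comm (toℕ u) n) (ℕ.+-monoʳ-< (toℕ u) 2k<n))
    backward : ∀ u v → toℕ v < toℕ u → toℕ v + n ≤ toℕ u + k → Arc D u v
    backward u v v<u bound = subst T (sym (trans (oriented λ eq → ℕ.<-irrefl (cong toℕ (sym eq)) v<u)
      (cong not (trans (D-< v u v<u) (dec-false (toℕ u + k <? n + toℕ v)
        (ℕ.≤⇒≯ (subst (_≤ toℕ u + k) (ℕ.+-comm (toℕ v) n) bound))))))) _

-- Sign matrices of digraphs.

module Quasirandomness where

  open import Data.Integer using (ℤ; +_; -[1+_]; -_; 0ℤ; 1ℤ; -1ℤ; _+_; _-_; _*_; _≤_; _<_; +≤+; +<+; -≤+; _<?_)
  open import Algebra.Properties.Semiring.Sum ℤ.+-*-semiring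
  open IntegerSums
  open Inversions

  sign : ∀ {n} → Digraph (Fin n) → Fin n → Fin n → ℤ
  sign D u v = ⟦ D u v ⟧ - ⟦ D v u ⟧

  sign-antisym : ∀ {n} (D : Digraph (Fin n)) u v → sign D v u ≡ - sign D u v
  sign-antisym D u v = lemma ⟦ D u v ⟧ ⟦ D v u ⟧
    where
    lemma : ∀ x y → y - x ≡ - (x - y)
    lemma = solve-∀

  Unit : ℤ → Set
  Unit x = -1ℤ ≤ x × x ≤ 1ℤ

  unit-sign : ∀ {n} (D : Digraph (Fin n)) u v → Unit (sign D u v)
  unit-sign D u v with D u v | D v u
  ... | true  | true  = -≤+ , 0≤pos
  ... | true  | false = -≤+ , ℤ.≤-refl
  ... | false | true  = ℤ.≤-refl , -≤+
  ... | false | false = -≤+ , 0≤pos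

  unit-⟦⟧* : ∀ b {x} → Unit x → Unit (⟦ b ⟧ * x)
  unit-⟦⟧* true  {x} ux = subst Unit (sym (ℤ.*-identityˡ x)) ux
  unit-⟦⟧* false {x} ux = -≤+ , 0≤pos

  unit-* : ∀ {x y} → Unit x → Unit y → Unit (x * y)
  unit-* {x} {y} (l , u) (l′ , u′) =
    *-cancel-≤ {+ 2} { -1ℤ } (+<+ ℕ.z<s) (≤-byDifference ((x - -1ℤ) * (y - -1ℤ) + (1ℤ - x) * (1ℤ - y))
      (0≤+ (0≤* (0≤- l) (0≤- l′)) (0≤* (0≤- u) (0≤- u′))) (lower x y)) ,
    *-cancel-≤ {+ 2} {x * y} (+<+ ℕ.z<s) (≤-byDifference ((x - -1ℤ) * (1ℤ - y) + (1ℤ - x) * (y - -1ℤ))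
      (0≤+ (0≤* (0≤- l) (0≤- u′)) (0≤* (0≤- u) (0≤- l′))) (upper x y))
    where
    lower : ∀ x y → + 2 * (x * y) ≡ + 2 * -1ℤ + ((x - -1ℤ) * (y - -1ℤ) + (1ℤ - x) * (1ℤ - y))
    lower = solve-∀
    upper : ∀ x y → + 2 * 1ℤ ≡ + 2 * (x * y) + ((x - -1ℤ) * (1ℤ - y) + (1ℤ - x) * (y - -1ℤ))
    upper = solve-∀

  ⟦⟧*-≤ : ∀ b {x} → Unit x → ⟦ b ⟧ * x ≤ ⟦ b ⟧
  ⟦⟧*-≤ true  {x} (_ , u) = subst (_≤ 1ℤ) (sym (ℤ.*-identityˡ x)) u
  ⟦⟧*-≤ false {x} _       = ℤ.≤-refl

  -⟦⟧≤⟦⟧* : ∀ b {x} → Unit x → - ⟦ b ⟧ ≤ ⟦ b ⟧ * x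
  -⟦⟧≤⟦⟧* true  {x} (l , _) = subst (-1ℤ ≤_) (sym (ℤ.*-identityˡ x)) l
  -⟦⟧≤⟦⟧* false {x} _       = ℤ.≤-refl

  square-⟦⟧*-≤ : ∀ b x → (⟦ b ⟧ * x) * (⟦ b ⟧ * x) ≤ x * x
  square-⟦⟧*-≤ true  x = ℤ.≤-reflexive (cong (λ y → y * y) (ℤ.*-identityˡ x))
  square-⟦⟧*-≤ false x = 0≤square x

  sgn-* : ∀ b x y → sgn b x * y ≡ sgn b (x * y)
  sgn-* true  x y = sym (ℤ.neg-distribˡ-* x y)
  sgn-* false x y = refl

  *-sgn : ∀ b x y → x * sgn b y ≡ sgn b (x * y)
  *-sgn true  x y = sym (ℤ.neg-distribʳ-* x y)
  *-sgn false x y = refl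

  sgn-∑ : ∀ b {n} (f : Fin n → ℤ) → sgn b (sum f) ≡ ∑[ i < n ] sgn b (f i)
  sgn-∑ true  f = sym (∑-neg f)
  sgn-∑ false f = refl

  ∑-sgn-fibres : ∀ {n s} (c : Fin n → Fin s) (σ : Fin s → Bool) (f : Fin n → ℤ) →
    ∑[ i < s ] sgn (σ i) (∑[ u < n ] (⟦ does (c u Fin.≟ i) ⟧ * f u)) ≡ ∑[ u < n ] sgn (σ (c u)) (f u)
  ∑-sgn-fibres c σ f = trans
    (sum-cong-≗ λ i → trans (sgn-∑ (σ i) λ u → ⟦ does (c u Fin.≟ i) ⟧ * f u)
      (sum-cong-≗ λ u → trans (sym (*-sgn (σ i) ⟦ does (c u Fin.≟ i) ⟧ (f u))) (recolour i u)))
    (sym (∑-fibres c λ u → sgn (σ (c u)) (f u)))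
    where
    recolour : ∀ i u → ⟦ does (c u Fin.≟ i) ⟧ * sgn (σ i) (f u) ≡ ⟦ does (c u Fin.≟ i) ⟧ * sgn (σ (c u)) (f u)
    recolour i u with c u Fin.≟ i
    ... | yes refl = refl
    ... | no  _    = refl

  -- Greedy reversals between classes that make the correlations small.

  module Balancing {n s b : ℕ} (c : Fin n → Fin s)
    (classSize : ∀ i → ∑[ u < n ] ⟦ does (c u Fin.≟ i) ⟧ ≤ + b) where

    lt : Fin n → Fin n → Bool
    lt u v = does (c u Fin.<? c v)

    upper : Digraph (Fin n) → Fin n → Fin n → ℤ
    upper D u v = ⟦ lt u v ⟧ * sign D u v

    correlation : Digraph (Fin n) → Fin n → Fin n → ℤ
    correlation D v v′ = ∑[ u < n ] (upper D u v * upper D u v′)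

    -- Pairs inside class j are left out: stage j flips both factors of such a product alike, so
    -- their correlation cannot be influenced there.
    inColumn : Fin s → Fin n → Fin n → Bool
    inColumn j v v′ = does (c v Fin.≟ j) ∧ does (c v′ Fin.<? j)

    column : Fin s → Digraph (Fin n) → Fin n → Fin n → ℤ
    column j D v v′ = ⟦ inColumn j v v′ ⟧ * correlation D v v′

    -- One summand for each of the s classes of u: its share has at most b · n nonzero entries in a
    -- column, each at most b in absolute value. Without signs the bound would be b · n · n², larger
    -- by a factor of order s when b is about n / s.
    columnBound : ℤ
    columnBound = + s * (+ b * (+ n * (+ b * + b)))

    unit-upper : ∀ D u v → Unit (upper D u v)
    unit-upper D u v = unit-⟦⟧* (lt u v) (unit-sign D u v)

    BoundedColumn : ℕ → Digraph (Fin n) → Set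
    BoundedColumn t D = ∀ j → toℕ j ≡ t → squaredNorm (column j D) ≤ columnBound

    upper-cong : ∀ {D D′} t → (∀ u v → toℕ (c u) ℕ.≤ t → toℕ (c v) ℕ.≤ t → D u v ≡ D′ u v) →
                 ∀ u v → toℕ (c v) ℕ.≤ t → upper D u v ≡ upper D′ u v
    upper-cong t same u v v≤t with c u Fin.<? c v
    ... | no  u≮v rewrite dec-false (c u Fin.<? c v) u≮v = refl
    ... | yes u<v rewrite dec-true (c u Fin.<? c v) u<v = cong₂ (λ x y → 1ℤ * (⟦ x ⟧ - ⟦ y ⟧)) (same u v u≤t v≤t) (same v u v≤t u≤t)
      where u≤t = ℕ.≤-trans (ℕ.<⇒≤ u<v) v≤t

    column-cong : ∀ {D D′} j → (∀ v v′ → c v ≡ j → toℕ (c v′) ℕ.< toℕ j → correlation D v v′ ≡ correlation D′ v v′) →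
                  ∀ v v′ → column j D v v′ ≡ column j D′ v v′
    column-cong j same v v′ with c v Fin.≟ j | c v′ Fin.<? j
    ... | yes v≡j | yes v′<j rewrite dec-true (c v′ Fin.<? j) v′<j = cong (1ℤ *_) (same v v′ v≡j v′<j)
    ... | yes _   | no v′≮j  rewrite dec-false (c v′ Fin.<? j) v′≮j = refl
    ... | no _    | _     = refl

    local : ∀ {t D D′} → (∀ u v → toℕ (c u) ℕ.≤ t → toℕ (c v) ℕ.≤ t → D u v ≡ D′ u v) →
            BoundedColumn t D → BoundedColumn t D′
    local {t} {D} {D′} same q j refl = subst (_≤ columnBound)
      (squaredNorm-cong (column-cong {D} {D′} j λ v v′ v≡j v′<j → sum-cong-≗ λ u →
        cong₂ _*_ (upper-cong t same u v (ℕ.≤-reflexive (cong toℕ v≡j)))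
                  (upper-cong t same u v′ (ℕ.<⇒≤ v′<j))))
      (q j refl)

    share : Digraph (Fin n) → Fin s → Fin n → Fin n → ℤ
    share D i v v′ = ∑[ u < n ] (⟦ does (c u Fin.≟ i) ⟧ * (upper D u v * upper D u v′))

    square-share-≤ : ∀ D i v v′ → share D i v v′ * share D i v v′ ≤ + b * + b
    square-share-≤ D i v v′ = square-≤
      (ℤ.≤-trans (ℤ.neg-mono-≤ (classSize i))
        (subst (_≤ share D i v v′) (∑-neg λ u → ⟦ does (c u Fin.≟ i) ⟧)
          (∑-mono λ u → -⟦⟧≤⟦⟧* (does (c u Fin.≟ i)) (unit-* (unit-upper D u v) (unit-upper D u v′)))))
      (ℤ.≤-trans (∑-mono λ u → ⟦⟧*-≤ (does (c u Fin.≟ i)) (unit-* (unit-upper D u v) (unit-upper D u v′)))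
        (classSize i))

    columnShare : Fin s → Digraph (Fin n) → Fin s → Fin n → Fin n → ℤ
    columnShare j D i v v′ = ⟦ inColumn j v v′ ⟧ * share D i v v′

    squaredNorm-columnShare-≤ : ∀ j D i → squaredNorm (columnShare j D i) ≤ + b * (+ n * (+ b * + b))
    squaredNorm-columnShare-≤ j D i = ℤ.≤-trans (∑-mono λ v → ∑-mono λ v′ → entry v v′)
      (subst (_≤ _) (sym (trans (sum-cong-≗ λ v → ∑-const n (⟦ does (c v Fin.≟ j) ⟧ * (+ b * + b)))
                                (trans (sum-cong-≗ λ v → rearrange (+ n) ⟦ does (c v Fin.≟ j) ⟧ (+ b * + b))
                                       (sym (*-distribʳ-sum (+ n * (+ b * + b)) λ v → ⟦ does (c v Fin.≟ j) ⟧)))))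
        (*-mono-≤-nonNeg (0≤∑ λ v → 0≤⟦ does (c v Fin.≟ j) ⟧) 0≤nbb (classSize j) ℤ.≤-refl))
      where
      0≤bb : 0ℤ ≤ + b * + b
      0≤bb = 0≤square (+ b)
      0≤nbb : 0ℤ ≤ + n * (+ b * + b)
      0≤nbb = 0≤* (0≤pos {n}) 0≤bb
      rearrange : ∀ n x y → n * (x * y) ≡ x * (n * y)
      rearrange = solve-∀
      entry : ∀ v v′ → columnShare j D i v v′ * columnShare j D i v v′ ≤ ⟦ does (c v Fin.≟ j) ⟧ * (+ b * + b)
      entry v v′ with does (c v Fin.≟ j) | does (c v′ Fin.<? j)
      ... | true  | true  = subst₂ _≤_ (cong (λ z → z * z) (sym (ℤ.*-identityˡ (share D i v v′))))
                              (sym (ℤ.*-identityˡ (+ b * + b))) (square-share-≤ D i v v′)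
      ... | true  | false = subst (0ℤ ≤_) (sym (ℤ.*-identityˡ (+ b * + b))) 0≤bb
      ... | false | _     = ℤ.≤-refl

    upper-reverse-≡ : ∀ D D′ j σ → (∀ u v → D′ u v ≡ reverseClass (toℕ ∘ c) (toℕ j) (σ ∘ c) D u v) →
      ∀ u v → c v ≡ j → upper D′ u v ≡ sgn (σ (c u)) (upper D u v)
    upper-reverse-≡ D D′ j σ described u v v≡j with c u Fin.<? c v
    ... | no  u≮v rewrite dec-false (c u Fin.<? c v) u≮v = sym (sgn-zero (σ (c u)))
      where
      sgn-zero : ∀ b → sgn b 0ℤ ≡ 0ℤ
      sgn-zero true  = refl
      sgn-zero false = refl
    ... | yes u<v
      rewrite dec-true (c u Fin.<? c v) u<v | described u v | described v u
            | proj₁ (reverseClass-≡ (toℕ ∘ c) D {a = σ ∘ c} {u = u} (cong toℕ v≡j))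
            | proj₂ (reverseClass-≡ (toℕ ∘ c) D {a = σ ∘ c} {u = u} (cong toℕ v≡j))
            | dec-true (toℕ (c u) ℕ.<? toℕ j) (subst (λ i → toℕ (c u) ℕ.< toℕ i) v≡j u<v)
      with σ (c u)
    ... | false = refl
    ... | true  = flip ⟦ D u v ⟧ ⟦ D v u ⟧
      where
      flip : ∀ x y → 1ℤ * (y - x) ≡ - (1ℤ * (x - y))
      flip = solve-∀

    upper-reverse-< : ∀ D D′ (j : Fin s) σ → (∀ u v → D′ u v ≡ reverseClass (toℕ ∘ c) (toℕ j) (σ ∘ c) D u v) →
      ∀ u v → toℕ (c v) ℕ.< toℕ j → upper D′ u v ≡ upper D u v
    upper-reverse-< D D′ j σ described u v v<j with c u Fin.<? c v
    ... | no  u≮v rewrite dec-false (c u Fin.<? c v) u≮v = refl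
    ... | yes u<v
      rewrite dec-true (c u Fin.<? c v) u<v | described u v | described v u
            | reverseClass-< (toℕ ∘ c) D {a = σ ∘ c} (ℕ.<-trans u<v v<j) v<j
            | reverseClass-< (toℕ ∘ c) D {a = σ ∘ c} v<j (ℕ.<-trans u<v v<j) = refl

    signedSum-columnShare : ∀ j D σ v v′ → signedSum σ (columnShare j D) v v′ ≡
      ⟦ inColumn j v v′ ⟧ * ∑[ u < n ] sgn (σ (c u)) (upper D u v * upper D u v′)
    signedSum-columnShare j D σ v v′ = trans
      (sum-cong-≗ λ i → sym (*-sgn (σ i) m (share D i v v′)))
      (trans (sym (*-distribˡ-sum m λ i → sgn (σ i) (share D i v v′)))
             (cong (m *_) (∑-sgn-fibres c σ λ u → upper D u v * upper D u v′)))
      where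
      m : ℤ
      m = ⟦ inColumn j v v′ ⟧

    -- For v in class j the entry of an earlier u is multiplied by the sign of the class of u, while
    -- the entries in the columns of earlier v′ stay fixed. The new column is thus exactly the
    -- signed sum of the shares that `balance` bounds, simultaneously for all v and v′.
    step : ∀ j D → ∃[ a ] (∀ D′ → (∀ u v → D′ u v ≡ reverseClass (toℕ ∘ c) (toℕ j) a D u v) →
           squaredNorm (column j D′) ≤ columnBound)
    step j D = fromSigns (balance (columnShare j D))
      where
      fromSigns : ∃[ σ ] squaredNorm (signedSum σ (columnShare j D)) ≤ ∑[ i < s ] squaredNorm (columnShare j D i) →
        ∃[ a ] (∀ D′ → (∀ u v → D′ u v ≡ reverseClass (toℕ ∘ c) (toℕ j) a D u v) →
          squaredNorm (column j D′) ≤ columnBound)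
      fromSigns (σ , bound) = σ ∘ c , λ D′ described →
        subst (_≤ columnBound) (squaredNorm-cong λ v v′ → sym (columns D′ described v v′))
          (ℤ.≤-trans bound (∑-≤-const (squaredNorm-columnShare-≤ j D)))
        where
        columns : ∀ D′ → (∀ u v → D′ u v ≡ reverseClass (toℕ ∘ c) (toℕ j) (σ ∘ c) D u v) →
                  ∀ v v′ → column j D′ v v′ ≡ signedSum σ (columnShare j D) v v′
        columns D′ described v v′ = trans atEntry (sym (signedSum-columnShare j D σ v v′))
          where
          atEntry : column j D′ v v′ ≡
            ⟦ inColumn j v v′ ⟧ * ∑[ u < n ] sgn (σ (c u)) (upper D u v * upper D u v′)
          atEntry with c v Fin.≟ j | c v′ Fin.<? j
          ... | yes v≡j | yes v′<j rewrite dec-true (c v′ Fin.<? j) v′<j = cong (1ℤ *_) (sum-cong-≗ λ u → trans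
            (cong₂ _*_ (upper-reverse-≡ D D′ j σ described u v v≡j) (upper-reverse-< D D′ j σ described u v′ v′<j))
            (sgn-* (σ (c u)) (upper D u v) (upper D u v′)))
          ... | yes _   | no v′≮j rewrite dec-false (c v′ Fin.<? j) v′≮j = refl
          ... | no _    | _    = refl

    balancedColumns : ∀ T₀ → ∃[ Xs ] (length Xs ≡ s ℕ.* 3 ×
      (∀ j → squaredNorm (column j (invertAll T₀ Xs)) ≤ columnBound))
    balancedColumns T₀ =
      let Xs , len , bounded , _ = colourByColour (toℕ ∘ c) BoundedColumn local T₀ stage s
      in Xs , len , λ j → bounded (toℕ j) (Fin.toℕ<n j) j refl
      where
      stage : ∀ t D → AgreesFrom (toℕ ∘ c) t D T₀ →
        ∃[ a ] (∀ D′ → (∀ u v → D′ u v ≡ reverseClass (toℕ ∘ c) t a D u v) → BoundedColumn t D′)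
      stage t D _ with t ℕ.<? s
      ... | no t≮s = (λ _ → false) , λ D′ _ j j≡t → ⊥-elim (t≮s (subst (ℕ._< s) j≡t (Fin.toℕ<n j)))
      ... | yes t<s = proj₁ (step (Data.Fin.fromℕ< t<s) D) , λ D′ described j j≡t →
        subst (λ i → squaredNorm (column i D′) ≤ columnBound)
          (Fin.toℕ-injective (trans (Fin.toℕ-fromℕ< t<s) (sym j≡t)))
          (proj₂ (step (Data.Fin.fromℕ< t<s) D) D′ λ u v →
            trans (described u v) (cong (λ i → reverseClass (toℕ ∘ c) i (proj₁ (step (Data.Fin.fromℕ< t<s) D)) D u v) (sym (Fin.toℕ-fromℕ< t<s))))

  -- From small correlations to small discrepancy.

  weight : ∀ {n} → Digraph (Fin n) → (Fin n → Bool) → (Fin n → Bool) → ℤ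
  weight {n} D x y = ∑[ u < n ] ∑[ v < n ] (⟦ x u ⟧ * (⟦ y v ⟧ * sign D u v))

  -- The upper bound is two-sided in disguise: exchanging x and y negates the weight, since the sign
  -- matrix is antisymmetric.
  Quasirandom : ∀ {n} → ℤ → Digraph (Fin n) → Set
  Quasirandom {n} g D = ∀ x y → g * weight D x y ≤ + 3 * (+ n * + n)

  ∑∑-distrib-+ : ∀ {m n} (f g : Fin m → Fin n → ℤ) →
    ∑[ i < m ] ∑[ j < n ] (f i j + g i j) ≡ ∑[ i < m ] ∑[ j < n ] f i j + ∑[ i < m ] ∑[ j < n ] g i j
  ∑∑-distrib-+ f g = trans (sum-cong-≗ λ i → ∑-distrib-+ (f i) (g i)) (∑-distrib-+ (sum ∘ f) (sum ∘ g))

  module Discrepancy {n s b : ℕ} (c : Fin n → Fin s)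
    (classSize : ∀ i → ∑[ u < n ] ⟦ does (c u Fin.≟ i) ⟧ ≤ + b)
    (D : Digraph (Fin n)) where

    open Balancing c classSize

    eq : Fin n → Fin n → Bool
    eq u v = does (c v Fin.≟ c u)

    trichotomy : ∀ u v → ⟦ lt u v ⟧ + (⟦ lt v u ⟧ + ⟦ eq u v ⟧) ≡ 1ℤ
    trichotomy u v with Fin.<-cmp (c u) (c v)
    ... | tri< u<v u≢v v≮u rewrite dec-true (c u Fin.<? c v) u<v | dec-false (c v Fin.<? c u) v≮u
                                 | dec-false (c v Fin.≟ c u) (u≢v ∘ sym) = refl
    ... | tri≈ u≮v u≡v v≮u rewrite dec-false (c u Fin.<? c v) u≮v | dec-false (c v Fin.<? c u) v≮u
                                 | dec-true (c v Fin.≟ c u) (sym u≡v) = refl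
    ... | tri> u≮v u≢v v<u rewrite dec-false (c u Fin.<? c v) u≮v | dec-true (c v Fin.<? c u) v<u
                                 | dec-false (c v Fin.≟ c u) (u≢v ∘ sym) = refl

    splitByColour : ∀ u v x → x ≡ ⟦ lt u v ⟧ * x + (⟦ lt v u ⟧ * x + ⟦ eq u v ⟧ * x)
    splitByColour u v x = trans (sym (ℤ.*-identityˡ x)) (trans (cong (_* x) (sym (trichotomy u v)))
      (distribute ⟦ lt u v ⟧ ⟦ lt v u ⟧ ⟦ eq u v ⟧ x))
      where
      distribute : ∀ p q r x → (p + (q + r)) * x ≡ p * x + (q * x + r * x)
      distribute = solve-∀

    ∑-eq-≤ : ∑[ u < n ] ∑[ v < n ] ⟦ eq u v ⟧ ≤ + n * + b
    ∑-eq-≤ = ∑-≤-const λ u → classSize (c u)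

    K : Fin n → Fin n → ℤ
    K = correlation D

    K-sym : ∀ v v′ → K v v′ ≡ K v′ v
    K-sym v v′ = sum-cong-≗ λ u → ℤ.*-comm (upper D u v) (upper D u v′)

    square-K-≤ : ∀ v v′ → K v v′ * K v v′ ≤ + n * + n
    square-K-≤ v v′ = square-≤
      (subst (_≤ K v v′) (trans (∑-const n -1ℤ) (neg-one (+ n)))
        (∑-mono λ u → proj₁ (unit-* (unit-upper D u v) (unit-upper D u v′))))
      (subst (K v v′ ≤_) (ℤ.*-identityʳ (+ n))
        (∑-≤-const λ u → proj₂ (unit-* (unit-upper D u v) (unit-upper D u v′))))
      where
      neg-one : ∀ x → x * -1ℤ ≡ - x
      neg-one = solve-∀

    module _ (columns : ∀ j → squaredNorm (column j D) ≤ columnBound) where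

      ordered-≤ : ∑[ v < n ] ∑[ v′ < n ] (⟦ lt v′ v ⟧ * (K v v′ * K v v′)) ≤ + s * columnBound
      ordered-≤ = subst (_≤ + s * columnBound) collect (∑-≤-const columns)
        where
        entry : ∀ v v′ j → column j D v v′ * column j D v v′ ≡
                ⟦ does (c v Fin.≟ j) ⟧ * (⟦ does (c v′ Fin.<? j) ⟧ * (K v v′ * K v v′))
        entry v v′ j with does (c v Fin.≟ j) | does (c v′ Fin.<? j)
        ... | true  | true  = one (K v v′)
          where
          one : ∀ x → (1ℤ * x) * (1ℤ * x) ≡ 1ℤ * (1ℤ * (x * x))
          one = solve-∀
        ... | true  | false = refl
        ... | false | _     = refl
        collect : ∑[ j < s ] squaredNorm (column j D) ≡ ∑[ v < n ] ∑[ v′ < n ] (⟦ lt v′ v ⟧ * (K v v′ * K v v′))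
        collect = trans (∑-comm λ j v → ∑[ v′ < n ] (column j D v v′ * column j D v v′))
          (sum-cong-≗ λ v → trans (∑-comm λ j v′ → column j D v v′ * column j D v v′)
            (sum-cong-≗ λ v′ → trans (sum-cong-≗ (entry v v′))
              (∑-delta (c v) λ j → ⟦ does (c v′ Fin.<? j) ⟧ * (K v v′ * K v v′))))

      -- Pairs in different classes are counted once in either order, equally by symmetry of `K`,
      -- and each order sums the s columns. Inside the classes only |K| ≤ n is available, but there
      -- are at most n · b such pairs.
      squaredNorm-K-≤ : squaredNorm K ≤ (+ s * columnBound + + s * columnBound) + (+ n * + b) * (+ n * + n)
      squaredNorm-K-≤ = subst (_≤ (+ s * columnBound + + s * columnBound) + (+ n * + b) * (+ n * + n)) (sym split)
        (ℤ.+-mono-≤ (ℤ.+-mono-≤ (subst (_≤ + s * columnBound) (sym swap) ordered-≤) ordered-≤) diagonal)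
        where
        KK : Fin n → Fin n → ℤ
        KK v v′ = K v v′ * K v v′
        S₁ S₂ S₃ : ℤ
        S₁ = ∑[ v < n ] ∑[ v′ < n ] (⟦ lt v v′ ⟧ * KK v v′)
        S₂ = ∑[ v < n ] ∑[ v′ < n ] (⟦ lt v′ v ⟧ * KK v v′)
        S₃ = ∑[ v < n ] ∑[ v′ < n ] (⟦ eq v v′ ⟧ * KK v v′)
        split : squaredNorm K ≡ (S₁ + S₂) + S₃
        split = trans (sum-cong-≗ λ v → sum-cong-≗ λ v′ → splitByColour v v′ (KK v v′))
          (trans (∑∑-distrib-+ (λ v v′ → ⟦ lt v v′ ⟧ * KK v v′) _)
          (trans (cong (_+_ S₁) (∑∑-distrib-+ (λ v v′ → ⟦ lt v′ v ⟧ * KK v v′) (λ v v′ → ⟦ eq v v′ ⟧ * KK v v′)))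
                 (sym (ℤ.+-assoc S₁ S₂ S₃))))
        swap : S₁ ≡ S₂
        swap = trans (∑-comm λ v v′ → ⟦ lt v v′ ⟧ * KK v v′)
          (sum-cong-≗ λ v → sum-cong-≗ λ v′ → cong (λ z → ⟦ lt v′ v ⟧ * (z * z)) (K-sym v′ v))
        diagonal : S₃ ≤ (+ n * + b) * (+ n * + n)
        diagonal = ℤ.≤-trans
          (∑-mono λ v → ∑-mono λ v′ → *-monoˡ-≤-0≤ 0≤⟦ eq v v′ ⟧ (square-K-≤ v v′))
          (subst (_≤ (+ n * + b) * (+ n * + n))
            (trans (*-distribʳ-sum (+ n * + n) λ v → ∑[ v′ < n ] ⟦ eq v v′ ⟧)
                   (sum-cong-≗ λ v → *-distribʳ-sum (+ n * + n) λ v′ → ⟦ eq v v′ ⟧))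
            (*-mono-≤-nonNeg (0≤∑ λ v → 0≤∑ λ v′ → 0≤⟦ eq v v′ ⟧) (0≤square (+ n)) ∑-eq-≤ ℤ.≤-refl))

    upperWeight : (Fin n → Bool) → (Fin n → Bool) → ℤ
    upperWeight x y = ∑[ u < n ] (⟦ x u ⟧ * ∑[ v < n ] (⟦ y v ⟧ * upper D u v))

    -- Cauchy-Schwarz over u eliminates x and leaves n times a sum of correlations over v and v′ in
    -- y. Cauchy-Schwarz over v and then over v′ bounds the square of that sum by n² times the
    -- squared norm of `K`.
    upperWeight⁴-≤ : ∀ x y → (upperWeight x y * upperWeight x y) * (upperWeight x y * upperWeight x y) ≤
                     ((+ n * + n) * (+ n * + n)) * squaredNorm K
    upperWeight⁴-≤ x y = ℤ.≤-trans
      (*-mono-≤-nonNeg (0≤square (upperWeight x y)) (0≤square (upperWeight x y)) first first)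
      (subst₂ _≤_ (regroup (+ n) G) (regroup′ (+ n) (squaredNorm K)) (*-monoˡ-≤-0≤ (0≤square (+ n)) second))
      where
      r : Fin n → ℤ
      r u = ∑[ v < n ] (⟦ y v ⟧ * upper D u v)
      G : ℤ
      G = ∑[ v < n ] ∑[ v′ < n ] (⟦ y v ⟧ * (⟦ y v′ ⟧ * K v v′))
      rows : ∑[ u < n ] (r u * r u) ≡ G
      rows = begin
        ∑[ u < n ] (r u * r u)
          ≡⟨ sum-cong-≗ (λ u → ∑-product (λ v → ⟦ y v ⟧ * upper D u v) (λ v → ⟦ y v ⟧ * upper D u v)) ⟩
        ∑[ u < n ] ∑[ v < n ] ∑[ v′ < n ] ((⟦ y v ⟧ * upper D u v) * (⟦ y v′ ⟧ * upper D u v′))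
          ≡⟨ ∑-comm (λ u v → ∑[ v′ < n ] ((⟦ y v ⟧ * upper D u v) * (⟦ y v′ ⟧ * upper D u v′))) ⟩
        ∑[ v < n ] ∑[ u < n ] ∑[ v′ < n ] ((⟦ y v ⟧ * upper D u v) * (⟦ y v′ ⟧ * upper D u v′))
          ≡⟨ sum-cong-≗ (λ v → ∑-comm (λ u v′ → (⟦ y v ⟧ * upper D u v) * (⟦ y v′ ⟧ * upper D u v′))) ⟩
        ∑[ v < n ] ∑[ v′ < n ] ∑[ u < n ] ((⟦ y v ⟧ * upper D u v) * (⟦ y v′ ⟧ * upper D u v′))
          ≡⟨ sum-cong-≗ (λ v → sum-cong-≗ λ v′ → pull v v′) ⟩
        G ∎
        where
        open ≡-Reasoning
        shuffle : ∀ a b p q → (a * p) * (b * q) ≡ a * (b * (p * q))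
        shuffle = solve-∀
        pull : ∀ v v′ → ∑[ u < n ] ((⟦ y v ⟧ * upper D u v) * (⟦ y v′ ⟧ * upper D u v′)) ≡ ⟦ y v ⟧ * (⟦ y v′ ⟧ * K v v′)
        pull v v′ = trans (sum-cong-≗ λ u → shuffle ⟦ y v ⟧ ⟦ y v′ ⟧ (upper D u v) (upper D u v′))
          (trans (sym (*-distribˡ-sum ⟦ y v ⟧ λ u → ⟦ y v′ ⟧ * (upper D u v * upper D u v′)))
                 (cong (⟦ y v ⟧ *_) (sym (*-distribˡ-sum ⟦ y v′ ⟧ λ u → upper D u v * upper D u v′))))
      first : upperWeight x y * upperWeight x y ≤ + n * G
      first = ℤ.≤-trans (square-∑-≤ λ u → ⟦ x u ⟧ * r u)
        (*-monoˡ-≤-0≤ (0≤pos {n}) (subst (∑[ u < n ] ((⟦ x u ⟧ * r u) * (⟦ x u ⟧ * r u)) ≤_) rows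
          (∑-mono λ u → square-⟦⟧*-≤ (x u) (r u))))
      second : G * G ≤ + n * (+ n * squaredNorm K)
      second = ℤ.≤-trans (square-∑-≤ λ v → ∑[ v′ < n ] (⟦ y v ⟧ * (⟦ y v′ ⟧ * K v v′)))
        (*-monoˡ-≤-0≤ (0≤pos {n}) (subst (∑[ v < n ] (g v * g v) ≤_)
          (sym (*-distribˡ-sum (+ n) λ v → ∑[ v′ < n ] (K v v′ * K v v′)))
          (∑-mono λ v → ℤ.≤-trans (square-∑-≤ λ v′ → ⟦ y v ⟧ * (⟦ y v′ ⟧ * K v v′))
            (*-monoˡ-≤-0≤ (0≤pos {n}) (∑-mono λ v′ →
              ℤ.≤-trans (square-⟦⟧*-≤ (y v) (⟦ y v′ ⟧ * K v v′)) (square-⟦⟧*-≤ (y v′) (K v v′)))))))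
        where
        g : Fin n → ℤ
        g v = ∑[ v′ < n ] (⟦ y v ⟧ * (⟦ y v′ ⟧ * K v v′))
      regroup : ∀ n G → (n * n) * (G * G) ≡ (n * G) * (n * G)
      regroup = solve-∀
      regroup′ : ∀ n Q → (n * n) * (n * (n * Q)) ≡ ((n * n) * (n * n)) * Q
      regroup′ = solve-∀

    -- Pairs are sorted by the order of their classes. Antisymmetry turns the descending ones into
    -- ascending ones with x and y exchanged and a minus sign. Each of the three parts will cost n²
    -- / g, hence the 3 in `Quasirandom`.
    weight-split : ∀ x y → weight D x y ≡ (upperWeight x y - upperWeight y x) +
      ∑[ u < n ] ∑[ v < n ] (⟦ x u ⟧ * (⟦ y v ⟧ * (⟦ eq u v ⟧ * sign D u v)))
    weight-split x y = begin
      weight D x y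
        ≡⟨ sum-cong-≗ (λ u → sum-cong-≗ λ v → entry u v) ⟩
      ∑[ u < n ] ∑[ v < n ] (A u v + (- A′ u v + E u v))
        ≡⟨ ∑∑-distrib-+ A (λ u v → - A′ u v + E u v) ⟩
      ∑∑ A + ∑[ u < n ] ∑[ v < n ] (- A′ u v + E u v)
        ≡⟨ cong (_+_ (∑∑ A)) (∑∑-distrib-+ (λ u v → - A′ u v) E) ⟩
      ∑∑ A + (∑[ u < n ] ∑[ v < n ] (- A′ u v) + ∑∑ E)
        ≡⟨ ℤ.+-assoc (∑∑ A) _ (∑∑ E) ⟨
      (∑∑ A + ∑[ u < n ] ∑[ v < n ] (- A′ u v)) + ∑∑ E
        ≡⟨ cong (_+ ∑∑ E) (cong₂ _+_ (factor x y)
             (trans (sum-cong-≗ λ u → ∑-neg (A′ u)) (trans (∑-neg (sum ∘ A′)) (cong -_ flipped)))) ⟩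
      (upperWeight x y - upperWeight y x) + ∑∑ E ∎
      where
      open ≡-Reasoning
      ∑∑ : (Fin n → Fin n → ℤ) → ℤ
      ∑∑ f = ∑[ u < n ] ∑[ v < n ] f u v
      A A′ E : Fin n → Fin n → ℤ
      A u v = ⟦ x u ⟧ * (⟦ y v ⟧ * upper D u v)
      A′ u v = ⟦ y v ⟧ * (⟦ x u ⟧ * upper D v u)
      E u v = ⟦ x u ⟧ * (⟦ y v ⟧ * (⟦ eq u v ⟧ * sign D u v))
      expand : ∀ a b p q r → a * (b * (p + (q + r))) ≡ a * (b * p) + (b * (a * q) + a * (b * r))
      expand = solve-∀
      neg : ∀ a b l m → b * (a * (l * (- m))) ≡ - (b * (a * (l * m)))
      neg = solve-∀
      entry : ∀ u v → ⟦ x u ⟧ * (⟦ y v ⟧ * sign D u v) ≡ A u v + (- A′ u v + E u v)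
      entry u v = trans (cong (λ z → ⟦ x u ⟧ * (⟦ y v ⟧ * z)) (splitByColour u v (sign D u v)))
        (trans (expand ⟦ x u ⟧ ⟦ y v ⟧ (⟦ lt u v ⟧ * sign D u v) (⟦ lt v u ⟧ * sign D u v) (⟦ eq u v ⟧ * sign D u v))
          (cong (λ z → A u v + (z + E u v))
            (trans (cong (λ m → ⟦ y v ⟧ * (⟦ x u ⟧ * (⟦ lt v u ⟧ * m))) (sign-antisym D v u))
                   (neg ⟦ x u ⟧ ⟦ y v ⟧ ⟦ lt v u ⟧ (sign D v u)))))
      factor : ∀ x y → ∑[ u < n ] ∑[ v < n ] (⟦ x u ⟧ * (⟦ y v ⟧ * upper D u v)) ≡ upperWeight x y
      factor x y = sum-cong-≗ λ u → sym (*-distribˡ-sum ⟦ x u ⟧ λ v → ⟦ y v ⟧ * upper D u v)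
      flipped : ∑∑ A′ ≡ upperWeight y x
      flipped = trans (∑-comm A′) (factor y x)

    module _ (columns : ∀ j → squaredNorm (column j D) ≤ columnBound) (g : ℤ) (0≤g : 0ℤ ≤ g)
             (gb≤n : g * + b ≤ + n) (sb≤2n : + s * + b ≤ + 2 * + n)
             (g⁴b≤n : + 9 * ((g * g) * (g * g)) * + b ≤ + n) where

      g⁴*squaredNorm-K-≤ : ((g * g) * (g * g)) * squaredNorm K ≤ (+ n * + n) * (+ n * + n)
      g⁴*squaredNorm-K-≤ = ℤ.≤-trans
        (*-monoˡ-≤-0≤ 0≤g⁴ (ℤ.≤-trans (squaredNorm-K-≤ columns) estimate))
        (subst₂ _≤_ (regroup (+ n) G (+ b)) (cube (+ n)) (*-monoˡ-≤-0≤ 0≤n³ g⁴b≤n))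
        where
        G : ℤ
        G = (g * g) * (g * g)
        0≤g⁴ : 0ℤ ≤ G
        0≤g⁴ = 0≤square (g * g)
        0≤n³ : 0ℤ ≤ + n * (+ n * + n)
        0≤n³ = 0≤* (0≤pos {n}) (0≤square (+ n))
        regroup : ∀ n G b → (n * (n * n)) * (+ 9 * G * b) ≡ G * (+ 9 * ((n * (n * n)) * b))
        regroup = solve-∀
        cube : ∀ n → (n * (n * n)) * n ≡ (n * n) * (n * n)
        cube = solve-∀
        difference : ∀ n b X → + 9 * ((n * (n * n)) * b) ≡
          (+ 2 * (X * (n * b)) + (n * b) * (n * n)) + + 2 * ((n * b) * ((+ 2 * n) * (+ 2 * n) - X))
        difference = solve-∀
        shape : ∀ n b s → + 2 * (((s * b) * (s * b)) * (n * b)) + (n * b) * (n * n) ≡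
          (s * (s * (b * (n * (b * b)))) + s * (s * (b * (n * (b * b))))) + (n * b) * (n * n)
        shape = solve-∀
        0≤sb : 0ℤ ≤ + s * + b
        0≤sb = 0≤* (0≤pos {s}) (0≤pos {b})
        -- The 9 is 2 · 2² + 1: the two off-diagonal parts give 2 (s b)² n b with s b ≤ 2 n, the
        -- diagonal one gives n³ b.
        estimate : (+ s * columnBound + + s * columnBound) + (+ n * + b) * (+ n * + n) ≤
                   + 9 * ((+ n * (+ n * + n)) * + b)
        estimate = subst (_≤ + 9 * ((+ n * (+ n * + n)) * + b)) (shape (+ n) (+ b) (+ s))
          (≤-byDifference _ (0≤* (0≤pos {2}) (0≤* (0≤* (0≤pos {n}) (0≤pos {b}))
              (0≤- (*-mono-≤-nonNeg 0≤sb 0≤sb sb≤2n sb≤2n))))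
            (difference (+ n) (+ b) ((+ s * + b) * (+ s * + b))))

      g*upperWeight-≤ : ∀ x y → g * upperWeight x y ≤ + n * + n × - (g * upperWeight x y) ≤ + n * + n
      g*upperWeight-≤ x y = square-cancel-≤ 0≤nn squared ,
        square-cancel-≤ 0≤nn (subst (_≤ (+ n * + n) * (+ n * + n)) (negSquare (g * Λ)) squared)
        where
        Λ : ℤ
        Λ = upperWeight x y
        0≤nn : 0ℤ ≤ + n * + n
        0≤nn = 0≤square (+ n)
        negSquare : ∀ x → x * x ≡ (- x) * (- x)
        negSquare = solve-∀
        regroup : ∀ g Λ → ((g * g) * (g * g)) * ((Λ * Λ) * (Λ * Λ)) ≡ ((g * Λ) * (g * Λ)) * ((g * Λ) * (g * Λ))
        regroup = solve-∀
        exchange : ∀ G N Q → G * (N * Q) ≡ N * (G * Q)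
        exchange = solve-∀
        squared : (g * Λ) * (g * Λ) ≤ (+ n * + n) * (+ n * + n)
        squared = square-cancel-≤ (0≤square (+ n * + n)) (ℤ.≤-trans
          (subst₂ _≤_ (regroup g Λ) (exchange ((g * g) * (g * g)) ((+ n * + n) * (+ n * + n)) (squaredNorm K))
            (*-monoˡ-≤-0≤ (0≤square (g * g)) (upperWeight⁴-≤ x y)))
          (*-monoˡ-≤-0≤ (0≤square (+ n * + n)) g⁴*squaredNorm-K-≤))

      quasirandom : Quasirandom g D
      quasirandom x y = subst₂ _≤_
        (trans (collect g (upperWeight x y) (upperWeight y x) E) (cong (g *_) (sym (weight-split x y))))
        (three (+ n))
        (ℤ.+-mono-≤ (ℤ.+-mono-≤ (proj₁ (g*upperWeight-≤ x y)) (proj₂ (g*upperWeight-≤ y x)))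
          (ℤ.≤-trans (*-monoˡ-≤-0≤ 0≤g E-≤) (subst (_≤ + n * + n) (exchange (+ n) g (+ b)) (*-monoˡ-≤-0≤ (0≤pos {n}) gb≤n))))
        where
        E : ℤ
        E = ∑[ u < n ] ∑[ v < n ] (⟦ x u ⟧ * (⟦ y v ⟧ * (⟦ eq u v ⟧ * sign D u v)))
        E-≤ : E ≤ + n * + b
        E-≤ = ℤ.≤-trans (∑-mono λ u → ∑-mono λ v → entry u v) ∑-eq-≤
          where
          entry : ∀ u v → ⟦ x u ⟧ * (⟦ y v ⟧ * (⟦ eq u v ⟧ * sign D u v)) ≤ ⟦ eq u v ⟧
          entry u v = subst (_≤ ⟦ eq u v ⟧) (shuffle ⟦ eq u v ⟧ ⟦ x u ⟧ ⟦ y v ⟧ (sign D u v))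
            (⟦⟧*-≤ (eq u v) (unit-⟦⟧* (x u) (unit-⟦⟧* (y v) (unit-sign D u v))))
            where
            shuffle : ∀ e a b m → e * (a * (b * m)) ≡ a * (b * (e * m))
            shuffle = solve-∀
        collect : ∀ g a b e → (g * a + - (g * b)) + g * e ≡ g * ((a - b) + e)
        collect = solve-∀
        three : ∀ n → (n * n + n * n) + n * n ≡ + 3 * (n * n)
        three = solve-∀
        exchange : ∀ n g b → n * (g * b) ≡ g * (n * b)
        exchange = solve-∀

  -- The balanced core and its lack of cuts.

  count : ∀ {n} → (Fin n → Bool) → ℤ
  count {n} x = ∑[ v < n ] ⟦ x v ⟧

  0<count : ∀ {n} (x : Fin n → Bool) v → x v ≡ true → 0ℤ < count x
  0<count x v xv = ℤ.<-≤-trans (+<+ ℕ.z<s)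
    (subst (_≤ count x) (trans (∑-delta v λ w → ⟦ x w ⟧) (cong ⟦_⟧ xv))
      (∑-mono λ w → ℤ.≤-trans (*-mono-≤-nonNeg 0≤⟦ does (v Fin.≟ w) ⟧ 0≤⟦ x w ⟧ ⟦ does (v Fin.≟ w) ⟧≤1 ℤ.≤-refl)
        (ℤ.≤-reflexive (ℤ.*-identityˡ ⟦ x w ⟧))))

  ≡-neg⇒≡0 : ∀ {x} → x ≡ - x → x ≡ 0ℤ
  ≡-neg⇒≡0 {+ ℕ.zero}  _ = refl

  -- A first-moment argument. The sum of d over the set is at least n / h per element and at most 3
  -- n² / g in total. For d the signed degree, this total is the discrepancy of the set against all
  -- vertices.
  count-heavy : ∀ {n} (x : Fin n → Bool) (d : Fin n → ℤ) {g h} → 0ℤ < + n → 0ℤ ≤ g → 0ℤ ≤ h →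
    (∀ u → x u ≡ true → + n ≤ h * d u) → g * ∑[ u < n ] (⟦ x u ⟧ * d u) ≤ + 3 * (+ n * + n) →
    g * count x ≤ + 3 * (h * + n)
  count-heavy {n} x d {g} {h} 0<n 0≤g 0≤h heavy bound = *-cancel-≤ 0<n (ℤ.≤-trans
    (subst₂ _≤_ (trans (cong (g *_) (sym (*-distribˡ-sum (+ n) (⟦_⟧ ∘ x)))) (exchange g (+ n) (count x)))
      (trans (cong (g *_) (sym (*-distribˡ-sum h λ u → ⟦ x u ⟧ * d u))) (exchange g h _))
      (*-monoˡ-≤-0≤ 0≤g (∑-mono pointwise)))
    (subst (h * (g * ∑[ u < n ] (⟦ x u ⟧ * d u)) ≤_) (rearrange h (+ n)) (*-monoˡ-≤-0≤ 0≤h bound)))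
    where
    exchange : ∀ a b c → a * (b * c) ≡ b * (a * c)
    exchange = solve-∀
    rearrange : ∀ h n → h * (+ 3 * (n * n)) ≡ n * (+ 3 * (h * n))
    rearrange = solve-∀
    pointwise : ∀ u → + n * ⟦ x u ⟧ ≤ h * (⟦ x u ⟧ * d u)
    pointwise u with x u in xu
    ... | true  = subst₂ _≤_ (sym (ℤ.*-identityʳ (+ n))) (cong (h *_) (sym (ℤ.*-identityˡ (d u)))) (heavy u xu)
    ... | false = ℤ.≤-reflexive (trans (ℤ.*-zeroʳ (+ n)) (sym (ℤ.*-zeroʳ h)))

  Partition : ∀ {n} → (a b z : Fin n → Bool) → Set
  Partition a b z = ∀ v → ⟦ a v ⟧ + (⟦ b v ⟧ + ⟦ z v ⟧) ≡ 1ℤ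

  count-partition : ∀ {n} {a b z : Fin n → Bool} → Partition a b z → count a + (count b + count z) ≡ + n
  count-partition {n} {a} {b} {z} part = trans
    (sym (trans (∑-distrib-+ (⟦_⟧ ∘ a) λ v → ⟦ b v ⟧ + ⟦ z v ⟧)
                (cong (_+_ (count a)) (∑-distrib-+ (⟦_⟧ ∘ b) (⟦_⟧ ∘ z)))))
    (trans (sum-cong-≗ part) (trans (∑-const n 1ℤ) (ℤ.*-identityʳ (+ n))))

  -- Summing the row sums of N over b: the part inside b cancels by antisymmetry.
  cut-≤ : ∀ {n} (N : Fin n → Fin n → ℤ) → (∀ u v → N v u ≡ - N u v) → (∀ u v → Unit (N u v)) →
    ∀ {a b z : Fin n → Bool} → Partition a b z → (∀ u v → b u ≡ true → a v ≡ true → N u v ≡ -1ℤ) →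
    ∀ {h} → 0ℤ ≤ h → (∀ u → b u ≡ true → - + n ≤ h * ∑[ v < n ] N u v) →
    0ℤ < count b → h * count a ≤ + n + h * count z
  cut-≤ {n} N antisym unit {a} {b} {z} part cut {h} 0≤h rows 0<b = *-cancel-≤ 0<b
    (≤-byDifference _ (0≤+ (0≤- lower) (0≤* 0≤h (0≤- upper′))) (final (count b) (+ n) h (count a) (count z) total))
    where
    ∑∑ : (Fin n → Fin n → ℤ) → ℤ
    ∑∑ f = ∑[ u < n ] ∑[ v < n ] f u v
    total : ℤ
    total = ∑[ u < n ] (⟦ b u ⟧ * ∑[ v < n ] N u v)
    lower : - + n * count b ≤ h * total
    lower = subst₂ _≤_ (sym (*-distribˡ-sum (- + n) (⟦_⟧ ∘ b))) 
      (sym (*-distribˡ-sum h λ u → ⟦ b u ⟧ * ∑[ v < n ] N u v)) (∑-mono pointwise)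
      where
      pointwise : ∀ u → - + n * ⟦ b u ⟧ ≤ h * (⟦ b u ⟧ * ∑[ v < n ] N u v)
      pointwise u with b u in bu
      ... | true  = subst₂ _≤_ (sym (ℤ.*-identityʳ (- + n))) (cong (h *_) (sym (ℤ.*-identityˡ _))) (rows u bu)
      ... | false = ℤ.≤-reflexive (trans (ℤ.*-zeroʳ (- + n)) (sym (ℤ.*-zeroʳ h)))
    inner : ∑∑ (λ u v → ⟦ b u ⟧ * (⟦ b v ⟧ * N u v)) ≡ 0ℤ
    inner = ≡-neg⇒≡0 (trans (∑-comm λ u v → ⟦ b u ⟧ * (⟦ b v ⟧ * N u v))
      (trans (sum-cong-≗ λ v → trans (sum-cong-≗ λ u →
          trans (cong (λ m → ⟦ b u ⟧ * (⟦ b v ⟧ * m)) (antisym v u)) (negate ⟦ b u ⟧ ⟦ b v ⟧ (N v u)))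
        (∑-neg λ u → ⟦ b v ⟧ * (⟦ b u ⟧ * N v u)))
      (∑-neg λ v → ∑[ u < n ] (⟦ b v ⟧ * (⟦ b u ⟧ * N v u)))))
      where
      negate : ∀ p q m → p * (q * - m) ≡ - (q * (p * m))
      negate = solve-∀
    upper′ : total ≤ - (count b * count a) + count b * count z
    upper′ = ℤ.≤-trans (ℤ.≤-reflexive spread) (ℤ.≤-trans (∑-mono λ u → ∑-mono λ v → pointwise u v) (ℤ.≤-reflexive collect))
      where
      expand : ∀ p q r s m → p * ((q + (r + s)) * m) ≡ p * (q * m) + (p * (r * m) + p * (s * m))
      expand = solve-∀
      spread : total ≡ ∑∑ (λ u v → ⟦ b u ⟧ * (⟦ a v ⟧ * N u v) + (⟦ b u ⟧ * (⟦ b v ⟧ * N u v) + ⟦ b u ⟧ * (⟦ z v ⟧ * N u v)))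
      spread = sum-cong-≗ λ u → trans (*-distribˡ-sum ⟦ b u ⟧ (N u)) (sum-cong-≗ λ v →
        trans (cong (⟦ b u ⟧ *_) (trans (sym (ℤ.*-identityˡ (N u v))) (cong (_* N u v) (sym (part v)))))
              (expand ⟦ b u ⟧ ⟦ a v ⟧ ⟦ b v ⟧ ⟦ z v ⟧ (N u v)))
      cutEntry : ∀ u v → ⟦ b u ⟧ * (⟦ a v ⟧ * N u v) ≡ - (⟦ b u ⟧ * ⟦ a v ⟧)
      cutEntry u v with b u in bu | a v in av
      ... | true  | true  = trans (trans (ℤ.*-identityˡ _) (ℤ.*-identityˡ (N u v))) (cut u v bu av)
      ... | true  | false = refl
      ... | false | _     = refl
      pointwise : ∀ u v → ⟦ b u ⟧ * (⟦ a v ⟧ * N u v) + (⟦ b u ⟧ * (⟦ b v ⟧ * N u v) + ⟦ b u ⟧ * (⟦ z v ⟧ * N u v))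
                  ≤ - (⟦ b u ⟧ * ⟦ a v ⟧) + (⟦ b u ⟧ * (⟦ b v ⟧ * N u v) + ⟦ b u ⟧ * ⟦ z v ⟧)
      pointwise u v = ℤ.+-mono-≤ (ℤ.≤-reflexive (cutEntry u v))
        (ℤ.+-monoʳ-≤ (⟦ b u ⟧ * (⟦ b v ⟧ * N u v)) (*-monoˡ-≤-0≤ 0≤⟦ b u ⟧ (⟦⟧*-≤ (z v) (unit u v))))
      collect : ∑∑ (λ u v → - (⟦ b u ⟧ * ⟦ a v ⟧) + (⟦ b u ⟧ * (⟦ b v ⟧ * N u v) + ⟦ b u ⟧ * ⟦ z v ⟧))
                ≡ - (count b * count a) + count b * count z
      collect = trans (∑∑-distrib-+ (λ u v → - (⟦ b u ⟧ * ⟦ a v ⟧)) _)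
        (cong₂ _+_
          (trans (sum-cong-≗ λ u → ∑-neg λ v → ⟦ b u ⟧ * ⟦ a v ⟧)
            (trans (∑-neg λ u → ∑[ v < n ] (⟦ b u ⟧ * ⟦ a v ⟧)) (cong -_ (sym (∑-product (⟦_⟧ ∘ b) (⟦_⟧ ∘ a))))))
          (trans (∑∑-distrib-+ (λ u v → ⟦ b u ⟧ * (⟦ b v ⟧ * N u v)) _)
            (trans (cong₂ _+_ inner (sym (∑-product (⟦_⟧ ∘ b) (⟦_⟧ ∘ z)))) (ℤ.+-identityˡ _))))
    final : ∀ B n h A Z t → B * (n + h * Z) ≡ B * (h * A) + ((h * t - - n * B) + h * ((- (B * A) + B * Z) - t))
    final = solve-∀

  module Core {n : ℕ} (0<n : 0ℤ < + n) (P k : ℕ) (large : + P * (+ 2 * + k) + + n ≤ + P * + n)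
    (D : Digraph (Fin n)) (quasi : Quasirandom (+ 192 * (+ P * + P)) D) (0<P : 0ℤ < + P) where

    -- Chosen so that the set E of exceptional vertices satisfies 8 P |E| ≤ n, and so
    -- that a cut A ⇒ B with 2 P |A| ≥ n and 2 P |B| ≥ n has weight above 3 n² / g.
    g h : ℤ
    g = + 192 * (+ P * + P)
    h = + 4 * + P

    0≤g : 0ℤ ≤ g
    0≤g = 0≤* (0≤pos {192}) (0≤square (+ P))

    0≤h : 0ℤ ≤ h
    0≤h = 0≤* (0≤pos {4}) (0≤pos {P})

    degree : Fin n → ℤ
    degree u = ∑[ v < n ] sign D u v

    -- The exceptional vertices: in- and outdegree differ by more than n / h.
    e⁺ e⁻ e : Fin n → Bool
    e⁺ u = does (+ n <? h * degree u)
    e⁻ u = does (+ n <? h * - degree u)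
    e u = e⁺ u ∨ e⁻ u

    count-e⁺ : g * count e⁺ ≤ + 3 * (h * + n)
    count-e⁺ = count-heavy e⁺ degree 0<n 0≤g 0≤h heavy
      (subst (λ w → g * w ≤ + 3 * (+ n * + n)) (sum-cong-≗ λ u → trans
          (sum-cong-≗ λ v → cong (⟦ e⁺ u ⟧ *_) (ℤ.*-identityˡ (sign D u v))) (sym (*-distribˡ-sum ⟦ e⁺ u ⟧ (sign D u))))
        (quasi e⁺ λ _ → true))
      where
      heavy : ∀ u → e⁺ u ≡ true → + n ≤ h * degree u
      heavy u eq with + n <? h * degree u
      ... | yes n< = ℤ.<⇒≤ n<

    count-e⁻ : g * count e⁻ ≤ + 3 * (h * + n)
    count-e⁻ = count-heavy e⁻ (-_ ∘ degree) 0<n 0≤g 0≤h heavy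
      (subst (λ w → g * w ≤ + 3 * (+ n * + n))
        (trans (∑-comm λ u v → 1ℤ * (⟦ e⁻ v ⟧ * sign D u v)) (sum-cong-≗ λ v →
          trans (sum-cong-≗ λ u → trans (ℤ.*-identityˡ _) (cong (⟦ e⁻ v ⟧ *_) (sign-antisym D v u)))
            (trans (sym (*-distribˡ-sum ⟦ e⁻ v ⟧ λ u → - sign D v u)) (cong (⟦ e⁻ v ⟧ *_) (∑-neg (sign D v))))))
        (quasi (λ _ → true) e⁻))
      where
      heavy : ∀ u → e⁻ u ≡ true → + n ≤ h * - degree u
      heavy u eq with + n <? h * - degree u
      ... | yes n< = ℤ.<⇒≤ n<

    -- The two kinds together give g |E| ≤ 6 h n = 24 P n, so 192 = 24 · 8 is what this bound
    -- demands of `g`.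
    count-e : + 8 * + P * count e ≤ + n
    count-e = *-cancel-≤ {+ 24 * + P} (ℤ.*-monoˡ-<-pos (+ 24) 0<P)
      (ℤ.≤-trans (subst (_≤ g * (count e⁺ + count e⁻)) (regroup (+ P) (count e)) (*-monoˡ-≤-0≤ 0≤g union))
        (subst₂ _≤_ (sym (ℤ.*-distribˡ-+ g (count e⁺) (count e⁻))) (total (+ P) (+ n)) (ℤ.+-mono-≤ count-e⁺ count-e⁻)))
      where
      regroup : ∀ P E → + 192 * (P * P) * E ≡ (+ 24 * P) * (+ 8 * P * E)
      regroup = solve-∀
      total : ∀ P n → + 3 * (+ 4 * P * n) + + 3 * (+ 4 * P * n) ≡ (+ 24 * P) * n
      total = solve-∀
      union : count e ≤ count e⁺ + count e⁻
      union = subst (count e ≤_) (∑-distrib-+ (⟦_⟧ ∘ e⁺) (⟦_⟧ ∘ e⁻)) (∑-mono λ u → ⟦∨⟧-≤ (e⁺ u) (e⁻ u))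

    balanced⁺ : ∀ u → e u ≡ false → - + n ≤ h * degree u
    balanced⁺ u eu with + n <? h * degree u | + n <? h * - degree u
    ... | no _ | no ≮ = subst (- + n ≤_) (negate h (degree u)) (ℤ.neg-mono-≤ (ℤ.≮⇒≥ ≮))
      where
      negate : ∀ h d → - (h * - d) ≡ h * d
      negate = solve-∀

    balanced⁻ : ∀ u → e u ≡ false → - + n ≤ h * - degree u
    balanced⁻ u eu with + n <? h * degree u
    ... | no ≮ = subst (- + n ≤_) (ℤ.neg-distribʳ-* h (degree u)) (ℤ.neg-mono-≤ (ℤ.≮⇒≥ ≮))

    -- All arcs between the two sides run from a to b, so the weight equals |A| |B|. Both sides have
    -- at least n / (2 P) vertices, which makes g |A| |B| at least 48 n², against the 3 n² allowed.
    no-cut : ∀ (S a b : Fin n → Bool) → count S ≤ + k → Partition a b (λ v → e v ∨ S v) →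
      (∀ u v → b u ≡ true → a v ≡ true → sign D u v ≡ -1ℤ) →
      0ℤ < count a → 0ℤ < count b → ⊥
    no-cut S a b S≤k part cut 0<a 0<b = absurd
      (*-cancel-≤ {+ n} {+ 48} 0<n (*-cancel-≤ 0<n
        (subst₂ _≤_ (regroup (+ n)) (regroup′ (+ n)) contradictory)))
      where
      z : Fin n → Bool
      z v = e v ∨ S v
      absurd : + 48 ≤ + 3 → ⊥
      absurd (+≤+ (ℕ.s≤s (ℕ.s≤s (ℕ.s≤s ()))))
      regroup : ∀ n → + 48 * (n * n) ≡ n * (n * + 48)
      regroup = solve-∀
      regroup′ : ∀ n → + 3 * (n * n) ≡ n * (n * + 3)
      regroup′ = solve-∀
      total : count a + (count b + count z) ≡ + n
      total = count-partition part
      outside : ∀ {p q r} v → ⟦ p ⟧ + (⟦ q ⟧ + ⟦ r ∨ S v ⟧) ≡ 1ℤ → q ≡ true → r ≡ false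
      outside {true}  {true} {true}  v () _
      outside {false} {true} {true}  v () _
      outside {_}     {true} {false} v _ _ = refl
      outside′ : ∀ {p q r} v → ⟦ p ⟧ + (⟦ q ⟧ + ⟦ r ∨ S v ⟧) ≡ 1ℤ → p ≡ true → r ≡ false
      outside′ {true} {true}  {true}  v () _
      outside′ {true} {false} {true}  v () _
      outside′ {true} {_}     {false} v _ _ = refl
      A≤ : h * count a ≤ + n + h * count z
      A≤ = cut-≤ (sign D) (sign-antisym D) (unit-sign D) {a} {b} {z} part cut 0≤h
        (λ u bu → balanced⁺ u (outside {a u} {b u} u (part u) bu)) 0<b
      B≤ : h * count b ≤ + n + h * count z
      B≤ = cut-≤ (λ u v → sign D v u) (λ u v → sign-antisym D v u) (λ u v → unit-sign D v u) {b} {a} {z}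
        (λ v → trans (swap ⟦ b v ⟧ ⟦ a v ⟧ ⟦ z v ⟧) (part v))
        (λ u v au bv → cut v u bv au) 0≤h
        (λ u au → subst (λ d → - + n ≤ h * d) (trans (sym (∑-neg (sign D u))) (sum-cong-≗ λ v → sym (sign-antisym D u v)))
          (balanced⁻ u (outside′ {a u} {b u} u (part u) au))) 0<a
        where
        swap : ∀ p q r → p + (q + r) ≡ q + (p + r)
        swap = solve-∀
      Z≤ : count z ≤ count e + + k
      Z≤ = ℤ.≤-trans (subst (count z ≤_) (∑-distrib-+ (⟦_⟧ ∘ e) (⟦_⟧ ∘ S)) (∑-mono λ v → ⟦∨⟧-≤ (e v) (S v)))
        (ℤ.+-monoʳ-≤ (count e) S≤k)
      -- Here x ≥ n - 2 |Z| - n / h and |Z| ≤ |E| + k. Of the n / P left by n - 2 k, the term n / h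
      -- takes n / (4 P) and 2 |E| takes at most n / (4 P), so n / (2 P) remains.
      half : ∀ x y → x + (y + count z) ≡ + n → h * y ≤ + n + h * count z → + n ≤ + 2 * + P * x
      half x y sum≡ y≤ = *-cancel-≤ {+ 2} (+<+ ℕ.z<s) (≤-byDifference _
        (0≤+ (0≤+ (0≤- y≤) (0≤* (0≤* (0≤pos {2}) 0≤h) (0≤- Z≤)))
             (0≤+ (0≤- count-e) (0≤* (0≤pos {4}) (0≤- large))))
        -- The ring identity carries (x + (y + |Z|)) - n as an explicit summand, which `sum≡` then
        -- makes vanish.
        (trans (combination (+ P) x (+ n) y (count z) (count e) (+ k))
          (trans (cong (λ t → + 4 * + P * (t - + n) + rest) sum≡) (vanish (+ P) (+ n) rest))))
        where
        rest : ℤ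
        rest = + 2 * + n +
          ((((+ n + h * count z) - h * y) + + 2 * h * ((count e + + k) - count z))
          + ((+ n - + 8 * + P * count e) + + 4 * (+ P * + n - (+ P * (+ 2 * + k) + + n))))
        combination : ∀ P x n y z E k → + 2 * (+ 2 * P * x) ≡ + 4 * P * ((x + (y + z)) - n) +
          (+ 2 * n +
          ((((n + + 4 * P * z) - + 4 * P * y) + + 2 * (+ 4 * P) * ((E + k) - z))
          + ((n - + 8 * P * E) + + 4 * (P * n - (P * (+ 2 * k) + n)))))
        combination = solve-∀
        vanish : ∀ P n r → + 4 * P * (n - n) + r ≡ r
        vanish = solve-∀
      weight≡ : weight D a b ≡ count a * count b
      weight≡ = trans (sum-cong-≗ λ u → sum-cong-≗ λ v → entry u v) (sym (∑-product (⟦_⟧ ∘ a) (⟦_⟧ ∘ b)))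
        where
        entry : ∀ u v → ⟦ a u ⟧ * (⟦ b v ⟧ * sign D u v) ≡ ⟦ a u ⟧ * ⟦ b v ⟧
        entry u v with a u in au | b v in bv
        ... | true  | true  = trans (trans (ℤ.*-identityˡ _) (ℤ.*-identityˡ (sign D u v)))
                                (trans (sign-antisym D v u) (cong -_ (cut v u bv au)))
        ... | true  | false = refl
        ... | false | _     = refl
      contradictory : + 48 * (+ n * + n) ≤ + 3 * (+ n * + n)
      contradictory = ℤ.≤-trans
        (subst (+ 48 * (+ n * + n) ≤_) (scale (+ P) (count a) (count b))
          (*-monoˡ-≤-0≤ (0≤pos {48}) (*-mono-≤-nonNeg (0≤pos {n}) (0≤pos {n})
            (half (count a) (count b) total B≤)
            (half (count b) (count a) (trans (swap (count b) (count a) (count z)) total) A≤))))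
        (subst (λ w → g * w ≤ + 3 * (+ n * + n)) weight≡ (quasi a b))
        where
        swap : ∀ p q r → p + (q + r) ≡ q + (p + r)
        swap = solve-∀
        scale : ∀ P A B → + 48 * ((+ 2 * P * A) * (+ 2 * P * B)) ≡ + 192 * (P * P) * (A * B)
        scale = solve-∀

    -- If every core vertex outside S has entry -1, the row sum over the core is at most 2 |S| + |E|
    -- - n ≤ -(n / P - n / (8 P)) = -7 n / (8 P). A balanced row has sum at least -n / (8 P), so 7 n
    -- ≤ n.
    no-blocked-row : ∀ (N : Fin n → ℤ) → (∀ v → Unit (N v)) → ∀ S → count S ≤ + k →
      (∀ v → e v ≡ false → S v ≡ false → N v ≡ -1ℤ) →
      + 8 * + P * - ∑[ v < n ] (⟦ not (e v) ⟧ * N v) ≤ + n → ⊥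
    no-blocked-row N unit S S≤k blocked bound = absurd (*-cancel-≤ {+ n} {+ 7} {1ℤ} 0<n
      (≤-byDifference _ (0≤+ (0≤+ (0≤- bound) (0≤* (0≤* (0≤pos {8}) (0≤pos {P})) (0≤- X≤)))
          (0≤+ (0≤* (0≤* (0≤pos {16}) (0≤pos {P})) (0≤- S≤k)) (0≤+ (0≤- count-e) (0≤* (0≤pos {8}) (0≤- large)))))
        (combination (+ P) (+ n) X (count S) (count e) (+ k))))
      where
      absurd : + 7 ≤ 1ℤ → ⊥
      absurd (+≤+ (ℕ.s≤s ()))
      X : ℤ
      X = ∑[ v < n ] (⟦ not (e v) ⟧ * N v)
      X≤ : X ≤ (+ 2 * count S + count e) - + n
      X≤ = ℤ.≤-trans (∑-mono pointwise) (ℤ.≤-reflexive (trans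
        (∑-distrib-+ (λ v → + 2 * ⟦ S v ⟧ + ⟦ e v ⟧) λ _ → -1ℤ)
        (cong₂ _+_ (trans (∑-distrib-+ (λ v → + 2 * ⟦ S v ⟧) (⟦_⟧ ∘ e)) (cong (_+ count e) (sym (*-distribˡ-sum (+ 2) (⟦_⟧ ∘ S)))))
          (trans (∑-const n -1ℤ) (neg-one (+ n))))))
        where
        neg-one : ∀ x → x * -1ℤ ≡ - x
        neg-one = solve-∀
        pointwise : ∀ v → ⟦ not (e v) ⟧ * N v ≤ (+ 2 * ⟦ S v ⟧ + ⟦ e v ⟧) + -1ℤ
        pointwise v with e v in ev | S v in Sv
        ... | true  | true  = 0≤pos
        ... | true  | false = ℤ.≤-refl
        ... | false | true  = subst (_≤ 1ℤ) (sym (ℤ.*-identityˡ (N v))) (proj₂ (unit v))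
        ... | false | false = ℤ.≤-reflexive (trans (ℤ.*-identityˡ (N v)) (blocked v ev Sv))
      combination : ∀ P n X s E k → n * 1ℤ ≡ n * + 7 +
        (((n - + 8 * P * - X) + + 8 * P * (((+ 2 * s + E) - n) - X))
        + (+ 16 * P * (k - s) + ((n - + 8 * P * E) + + 8 * (P * n - (P * (+ 2 * k) + n)))))
      combination = solve-∀

  -- Attaching the exceptional vertices to the core.

  count-lookup : ∀ {n} (S : Subset n) → count (lookup S) ≡ + ∣ S ∣
  count-lookup []          = refl
  count-lookup (true  ∷ S) = cong (_+_ 1ℤ) (count-lookup S)
  count-lookup (false ∷ S) = trans (ℤ.+-identityˡ _) (count-lookup S)

  ∉⇒lookup≡false : ∀ {n} (S : Subset n) {v} → v ∉ S → lookup S v ≡ false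
  ∉⇒lookup≡false S {v} v∉S = trans (sym (does-∈? S v)) (dec-false (v ∈? S) v∉S)

  lookup≡false⇒∉ : ∀ {n} (S : Subset n) {v} → lookup S v ≡ false → v ∉ S
  lookup≡false⇒∉ S {v} Sv with v ∈? S | does-∈? S v
  ... | yes _  | eq = λ _ → case (trans eq Sv)
    where
    case : true ≡ false → ⊥
    case ()
  ... | no v∉S | _  = v∉S

  module Completion {n : ℕ} (0<n : 0ℤ < + n) (P k : ℕ) (large : + P * (+ 2 * + k) + + n ≤ + P * + n)
    (D : Digraph (Fin n)) (quasi : Quasirandom (+ 192 * (+ P * + P)) D) (0<P : 0ℤ < + P)
    (tour : IsTournament D) (k+1≤n : k ℕ.+ 1 ℕ.≤ n)
    {s b : ℕ} (c : Fin n → Fin s) (classSize : ∀ i → ∑[ u < n ] ⟦ does (c u Fin.≟ i) ⟧ ≤ + b)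
    (64P²sb²≤n² : + 64 * (+ P * + P) * (+ s * (+ b * + b)) ≤ + n * + n) where

    open Core 0<n P k large D quasi 0<P

    share : Fin n → Fin s → ℤ
    share u i = ∑[ w < n ] (⟦ does (c w Fin.≟ i) ⟧ * (⟦ not (e w) ⟧ * sign D u w))

    square-share-≤ : ∀ u i → share u i * share u i ≤ + b * + b
    square-share-≤ u i = square-≤
      (ℤ.≤-trans (ℤ.neg-mono-≤ (classSize i))
        (subst (_≤ share u i) (∑-neg λ w → ⟦ does (c w Fin.≟ i) ⟧)
          (∑-mono λ w → -⟦⟧≤⟦⟧* (does (c w Fin.≟ i)) (unit-⟦⟧* (not (e w)) (unit-sign D u w)))))
      (ℤ.≤-trans (∑-mono λ w → ⟦⟧*-≤ (does (c w Fin.≟ i)) (unit-⟦⟧* (not (e w)) (unit-sign D u w))) (classSize i))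

    -- Here the balanced vectors are numbers, written as 1 by 1 matrices: each vertex u has its own
    -- signs on the classes, making its row sum over the core at most b √s in absolute value.
    signs : ∀ u → ∃[ σ ] squaredNorm {1} {1} (signedSum σ λ i _ _ → share u i)
                           ≤ ∑[ i < s ] squaredNorm {1} {1} (λ _ _ → share u i)
    signs u = balance {s} {1} {1} λ i _ _ → share u i

    σ : Fin n → Fin s → Bool
    σ u = proj₁ (signs u)

    rowSum : Fin n → ℤ
    rowSum u = ∑[ w < n ] (⟦ not (e w) ⟧ * sgn (σ u (c w)) (sign D u w))

    square-rowSum-≤ : ∀ u → rowSum u * rowSum u ≤ + s * (+ b * + b)
    square-rowSum-≤ u = subst (λ x → x * x ≤ + s * (+ b * + b)) row
      (ℤ.≤-trans (ℤ.≤-reflexive (sym (single (∑[ i < s ] sgn (σ u i) (share u i)))))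
        (ℤ.≤-trans (proj₂ (signs u))
          (∑-≤-const λ i → ℤ.≤-trans (ℤ.≤-reflexive (single (share u i))) (square-share-≤ u i))))
      where
      single : ∀ x → (x * x + 0ℤ) + 0ℤ ≡ x * x
      single = solve-∀
      row : ∑[ i < s ] sgn (σ u i) (share u i) ≡ rowSum u
      row = trans (∑-sgn-fibres c (σ u) λ w → ⟦ not (e w) ⟧ * sign D u w)
        (sum-cong-≗ λ w → sym (*-sgn (σ u (c w)) ⟦ not (e w) ⟧ (sign D u w)))

    8P*rowSum-≤ : ∀ u x → x * x ≡ rowSum u * rowSum u → + 8 * + P * x ≤ + n
    8P*rowSum-≤ u x eq = square-cancel-≤ (0≤pos {n}) (ℤ.≤-trans
      (ℤ.≤-reflexive (trans (regroup (+ P) x) (cong (+ 64 * (+ P * + P) *_) eq)))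
      (ℤ.≤-trans (*-monoˡ-≤-0≤ (0≤* (0≤pos {64}) (0≤square (+ P))) (square-rowSum-≤ u)) 64P²sb²≤n²))
      where
      regroup : ∀ P x → (+ 8 * P * x) * (+ 8 * P * x) ≡ + 64 * (P * P) * (x * x)
      regroup = solve-∀

    -- Placing the exceptional vertices below all classes lets one stage per class reverse its core
    -- part against an arbitrary set of exceptional vertices. The number of stages is s + 1 however
    -- many exceptional vertices there are.
    colour : Fin n → ℕ
    colour v = if e v then 0 else ℕ.suc (toℕ (c v))

    colour<s+1 : ∀ v → colour v ℕ.< ℕ.suc s
    colour<s+1 v with e v
    ... | true  = ℕ.z<s
    ... | false = ℕ.s<s (Fin.toℕ<n (c v))

    φ : ℕ → Fin n → Bool
    φ ℕ.zero    u = false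
    φ (ℕ.suc t) u with t ℕ.<? s
    ... | yes t<s = e u ∧ σ u (fromℕ< t<s)
    ... | no  _   = false

    φ-core : ∀ t u → e u ≡ false → φ t u ≡ false
    φ-core ℕ.zero    u eu = refl
    φ-core (ℕ.suc t) u eu with t ℕ.<? s
    ... | yes t<s = cong (_∧ σ u (fromℕ< t<s)) eu
    ... | no  _   = refl

    φ-class : ∀ i u → e u ≡ true → φ (ℕ.suc (toℕ i)) u ≡ σ u i
    φ-class i u eu with toℕ i ℕ.<? s
    ... | yes i<s = cong₂ _∧_ eu (cong (σ u) (Fin.fromℕ<-toℕ i i<s))
    ... | no  i≮s = ⊥-elim (i≮s (Fin.toℕ<n i))

    module _ (D′ : Digraph (Fin n)) (tour′ : IsTournament D′)
      (described : ∀ u v → colour u ℕ.≤ colour v →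
        D′ u v ≡ (if does (colour u ℕ.<? colour v) ∧ φ (colour v) u then D v u else D u v)) where

      ascending : ∀ u v → e u ≡ false → colour u ℕ.≤ colour v → D′ u v ≡ D u v
      ascending u v eu u≤v = trans (described u v u≤v) (cong (if_then D v u else D u v)
        (trans (cong (does (colour u ℕ.<? colour v) ∧_) (φ-core (colour v) u eu)) (∧-zeroʳ _)))

      -- This transfers `no-cut`, a statement about `D`, to the core of `D′`. It is why `φ` vanishes
      -- on core vertices.
      D′-core : ∀ u v → e u ≡ false → e v ≡ false → D′ u v ≡ D u v
      D′-core u v eu ev with u Fin.≟ v
      ... | yes refl = trans (IsTournament.loopless tour′ u) (sym (IsTournament.loopless tour u))
      ... | no  u≢v with ℕ.≤-total (colour u) (colour v)
      ...   | inj₁ u≤v = ascending u v eu u≤v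
      ...   | inj₂ v≤u = trans (IsTournament.oriented tour′ u≢v)
        (trans (cong not (ascending v u ev v≤u)) (sym (IsTournament.oriented tour u≢v)))

      D′-exceptional : ∀ u w → e u ≡ true → e w ≡ false → D′ u w ≡ (if σ u (c w) then D w u else D u w)
      D′-exceptional u w eu ew = trans (described u w (subst (ℕ._≤ colour w) (sym colour-u) ℕ.z≤n))
        (cong (if_then D w u else D u w) (cong₂ _∧_
          (dec-true (colour u ℕ.<? colour w) (subst₂ ℕ._<_ (sym colour-u) (sym colour-w) ℕ.z<s))
          (trans (cong (λ t → φ t u) colour-w) (φ-class (c w) u eu))))
        where
        colour-u : colour u ≡ 0
        colour-u rewrite eu = refl
        colour-w : colour w ≡ ℕ.suc (toℕ (c w))
        colour-w rewrite ew = refl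

      ≢-exceptional : ∀ {u w} → e u ≡ true → e w ≡ false → u ≢ w
      ≢-exceptional eu ew refl with trans (sym eu) ew
      ... | ()

      sign-exceptional : ∀ u w → e u ≡ true → e w ≡ false → sign D′ u w ≡ sgn (σ u (c w)) (sign D u w)
      sign-exceptional u w eu ew
        rewrite IsTournament.oriented tour′ (≢-exceptional eu ew ∘ sym) | D′-exceptional u w eu ew
              | IsTournament.oriented tour (≢-exceptional eu ew ∘ sym)
        with σ u (c w) | D u w
      ... | true  | true  = refl
      ... | true  | false = refl
      ... | false | true  = refl
      ... | false | false = refl

      rowSum-exceptional : ∀ u → e u ≡ true → ∑[ w < n ] (⟦ not (e w) ⟧ * sign D′ u w) ≡ rowSum u
      rowSum-exceptional u eu = sum-cong-≗ entry
        where
        entry : ∀ w → ⟦ not (e w) ⟧ * sign D′ u w ≡ ⟦ not (e w) ⟧ * sgn (σ u (c w)) (sign D u w)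
        entry w with e w in ew
        ... | true  = refl
        ... | false = cong (1ℤ *_) (sign-exceptional u w eu ew)

      sign-none : ∀ {u v} → u ≢ v → D′ u v ≡ false → sign D′ u v ≡ -1ℤ
      sign-none {u} {v} u≢v Duv rewrite IsTournament.oriented tour′ (u≢v ∘ sym) | Duv = refl

      ¬T⇒≡false : ∀ {x} → (T x → ⊥) → x ≡ false
      ¬T⇒≡false {true}  ¬t = ⊥-elim (¬t _)
      ¬T⇒≡false {false} ¬t = refl

      module _ (S : Subset n) (S<k : ∣ S ∣ ℕ.< k) where

        S≤k : count (lookup S) ≤ + k
        S≤k = subst (_≤ + k) (sym (count-lookup S)) (+≤+ (ℕ.<⇒≤ S<k))

        exit : ∀ u → e u ≡ true → ∃[ w ] (e w ≡ false × w ∉ S × Arc D′ u w)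
        exit u eu with Fin.any? (λ w → e w Data.Bool.≟ false ×-dec ¬? (w ∈? S) ×-dec T? (D′ u w))
        ... | yes found = found
        ... | no  none  = ⊥-elim (no-blocked-row (sign D′ u) (unit-sign D′ u) (lookup S) S≤k
          (λ w ew Sw → sign-none (≢-exceptional eu ew) (¬T⇒≡false λ arc → none (w , ew , lookup≡false⇒∉ S Sw , arc)))
          (8P*rowSum-≤ u _ (trans (negSquare (∑[ w < n ] (⟦ not (e w) ⟧ * sign D′ u w))) (cong (λ x → x * x) (rowSum-exceptional u eu)))))
          where
          negSquare : ∀ x → (- x) * (- x) ≡ x * x
          negSquare = solve-∀

        entry : ∀ u → e u ≡ true → ∃[ w ] (e w ≡ false × w ∉ S × Arc D′ w u)
        entry u eu with Fin.any? (λ w → e w Data.Bool.≟ false ×-dec ¬? (w ∈? S) ×-dec T? (D′ w u))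
        ... | yes found = found
        ... | no  none  = ⊥-elim (no-blocked-row (λ w → sign D′ w u) (λ w → unit-sign D′ w u) (lookup S) S≤k
          (λ w ew Sw → sign-none (≢-exceptional eu ew ∘ sym) (¬T⇒≡false λ arc → none (w , ew , lookup≡false⇒∉ S Sw , arc)))
          (8P*rowSum-≤ u _ (cong (λ x → x * x) (trans negated (rowSum-exceptional u eu)))))
          where
          negate : ∀ x y → - (x * - y) ≡ x * y
          negate = solve-∀
          negated : - ∑[ w < n ] (⟦ not (e w) ⟧ * sign D′ w u) ≡ ∑[ w < n ] (⟦ not (e w) ⟧ * sign D′ u w)
          negated = trans (sym (∑-neg λ w → ⟦ not (e w) ⟧ * sign D′ w u)) (sum-cong-≗ λ w →
            trans (cong (λ x → - (⟦ not (e w) ⟧ * x)) (sign-antisym D′ u w)) (negate ⟦ not (e w) ⟧ (sign D′ u w)))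

        inCore : Fin n → Bool
        inCore v = not (e v ∨ lookup S v)

        inCore⇒ : ∀ {v} → inCore v ≡ true → e v ≡ false × lookup S v ≡ false
        inCore⇒ {v} ok with e v | lookup S v
        ... | false | false = refl , refl

        inCore⇒∉ : ∀ {v} → T (inCore v) → v ∉ S
        inCore⇒∉ {v} ok = lookup≡false⇒∉ S (proj₂ (inCore⇒ {v} (Equivalence.to T-≡ ok)))

        ⇒inCore : ∀ {v} → e v ≡ false → v ∉ S → inCore v ≡ true
        ⇒inCore {v} ev v∉S rewrite ev | ∉⇒lookup≡false S v∉S = refl

        -- If v is not reached from u, let B be the reached and A the unreached core vertices. No
        -- arc runs from B to A, so in a tournament all run from A to B, and `no-cut` applies
        -- because u lies in B and v in A.
        corePath : ∀ u v → inCore u ≡ true → inCore v ≡ true → Star (Arc (into D′ S inCore)) u v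
        corePath u v cu cv = decide (reachableSet (into D′ S inCore) u)
          where
          decide : ∃[ R ] (u ∈ R × (∀ {w} → w ∈ R → Star (Arc (into D′ S inCore)) u w) × Closed (into D′ S inCore) R) →
                   Star (Arc (into D′ S inCore)) u v
          decide (R , u∈R , reach , closed) with v ∈? R
          ... | yes v∈R = reach v∈R
          ... | no  v∉R = ⊥-elim (no-cut (lookup S) A B S≤k part cut
                  (0<count A v (cong₂ _∧_ cv (cong not (∉⇒lookup≡false R v∉R))))
                  (0<count B u (cong₂ _∧_ cu (trans (sym (does-∈? R u)) (dec-true (u ∈? R) u∈R)))))
            where
            A B : Fin n → Bool
            A w = inCore w ∧ not (lookup R w)
            B w = inCore w ∧ lookup R w
            part : Partition A B (λ w → e w ∨ lookup S w)
            part w with e w ∨ lookup S w | lookup R w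
            ... | true  | _     = refl
            ... | false | true  = refl
            ... | false | false = refl
            split : ∀ {x y} → x ∧ y ≡ true → x ≡ true × y ≡ true
            split {true} {true} _ = refl , refl
            cut : ∀ x y → B x ≡ true → A y ≡ true → sign D x y ≡ -1ℤ
            cut x y bx ay = subst₂ (λ p q → ⟦ p ⟧ - ⟦ q ⟧ ≡ -1ℤ) (D′-core x y ex ey) (D′-core y x ey ex)
              (sign-none (λ { refl → y∉R x∈R }) (¬T⇒≡false λ arc →
                y∉R (closed x∈R (Equivalence.from T-∧ (arc , Equivalence.from T-≡ (proj₁ (split ay)))))))
              where
              ex = proj₁ (inCore⇒ {x} (proj₁ (split bx)))
              ey = proj₁ (inCore⇒ {y} (proj₁ (split ay)))
              x∈R : x ∈ R
              x∈R with x ∈? R | does-∈? R x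
              ... | yes x∈R | _ = x∈R
              ... | no  _   | eq with trans eq (proj₂ (split {inCore x} bx))
              ...   | ()
              y∉R : y ∉ R
              y∉R = lookup≡false⇒∉ R (not-true (proj₂ (split {inCore y} ay)))
                where
                not-true : ∀ {x} → not x ≡ true → x ≡ false
                not-true {false} _ = refl

        -- A path uses at most one arc to enter the core, stays in the core, and uses at most one
        -- arc to leave it.
        strong : StronglyConnected (D′ − S)
        strong (u , [ u∉S ]) (v , [ v∉S ]) = route (toCore u u∉S) (fromCore v v∉S)
          where
          toCore : ∀ u → .(u∉S : u ∉ S) → ∃[ w ] (e w ≡ false × ∃[ w∉S ] Star (Arc (D′ − S)) (u , [ u∉S ]) (w , [ w∉S ]))
          toCore u u∉S with e u in eu
          ... | false = u , eu , recompute (¬? (u ∈? S)) u∉S , ε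
          ... | true  = let w , ew , w∉S , arc = exit u eu in w , ew , w∉S , arc ◅ ε
          fromCore : ∀ v → .(v∉S : v ∉ S) → ∃[ w ] (e w ≡ false × ∃[ w∉S ] Star (Arc (D′ − S)) (w , [ w∉S ]) (v , [ v∉S ]))
          fromCore v v∉S with e v in ev
          ... | false = v , ev , recompute (¬? (v ∈? S)) v∉S , ε
          ... | true  = let w , ew , w∉S , arc = entry v ev in w , ew , w∉S , arc ◅ ε
          route : ∃[ w ] (e w ≡ false × ∃[ w∉S ] Star (Arc (D′ − S)) (u , [ u∉S ]) (w , [ w∉S ])) →
                  ∃[ w ] (e w ≡ false × ∃[ w∉S ] Star (Arc (D′ − S)) (w , [ w∉S ]) (v , [ v∉S ])) →
                  Star (Arc (D′ − S)) (u , [ u∉S ]) (v , [ v∉S ])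
          route (w , ew , w∉S , path) (w′ , ew′ , w′∉S , path′) = path ◅◅
            liftStar D′ S inCore⇒∉ w∉S w′∉S (corePath w w′ (⇒inCore ew w∉S) (⇒inCore ew′ w′∉S)) ◅◅ path′

    complete : ∃[ Xs ] (length Xs ≡ ℕ.suc s ℕ.* 3 × IsStrong k (invertAll D Xs))
    complete = finish (reverseClasses colour D φ (ℕ.suc s) colour<s+1)
      where
      finish : ∃[ Xs ] (length Xs ≡ ℕ.suc s ℕ.* 3 × (∀ u v → colour u ℕ.≤ colour v →
          invertAll D Xs u v ≡ (if does (colour u ℕ.<? colour v) ∧ φ (colour v) u then D v u else D u v))) →
        ∃[ Xs ] (length Xs ≡ ℕ.suc s ℕ.* 3 × IsStrong k (invertAll D Xs))
      finish (Xs , len , described) = Xs , len , k+1≤n ,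
        strong (invertAll D Xs) (invertAll-isTournament Xs tour) described

  -- Cutting the vertices into blocks and fixing the constants.

  ∑-++ : ∀ m {n} (f : Fin (m ℕ.+ n) → ℤ) →
         sum f ≡ ∑[ i < m ] f (i ↑ˡ n) + ∑[ j < n ] f (m ↑ʳ j)
  ∑-++ ℕ.zero    f = sym (ℤ.+-identityˡ _)
  ∑-++ (ℕ.suc m) f = trans (cong (_+_ (f zero)) (∑-++ m (f ∘ suc))) (sym (ℤ.+-assoc (f zero) _ _))

  ∑-combine : ∀ m n (f : Fin (m ℕ.* n) → ℤ) → sum f ≡ ∑[ i < m ] ∑[ j < n ] f (combine i j)
  ∑-combine ℕ.zero    n f = refl
  ∑-combine (ℕ.suc m) n f = trans (∑-++ n f) (cong (_+_ (∑[ j < n ] f (j ↑ˡ (m ℕ.* n)))) (∑-combine m n (f ∘ (n ↑ʳ_))))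

  ∑-inject≤ : ∀ {m n} (m≤n : m ℕ.≤ n) (f : Fin n → ℤ) → (∀ i → 0ℤ ≤ f i) → ∑[ i < m ] f (inject≤ i m≤n) ≤ sum f
  ∑-inject≤ ℕ.z≤n       f 0≤f = 0≤∑ 0≤f
  ∑-inject≤ (ℕ.s≤s m≤n) f 0≤f = ℤ.+-monoʳ-≤ (f zero) (∑-inject≤ m≤n (f ∘ suc) (0≤f ∘ suc))

  does-≟-sym : ∀ {n} (i j : Fin n) → does (i Fin.≟ j) ≡ does (j Fin.≟ i)
  does-≟-sym i j with i Fin.≟ j
  ... | yes i≡j = sym (dec-true (j Fin.≟ i) (sym i≡j))
  ... | no  i≢j = sym (dec-false (j Fin.≟ i) (i≢j ∘ sym))

  -- Consecutive blocks of length b, obtained by padding the vertex set to s · b elements; a class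
  -- can only lose elements when the padding is dropped.
  block : ∀ {n} s b → n ℕ.≤ s ℕ.* b → Fin n → Fin s
  block s b n≤sb v = quotient b (inject≤ v n≤sb)

  block-size : ∀ {n} s b (n≤sb : n ℕ.≤ s ℕ.* b) i → ∑[ u < n ] ⟦ does (block s b n≤sb u Fin.≟ i) ⟧ ≤ + b
  block-size s b n≤sb i = ℤ.≤-trans
    (∑-inject≤ n≤sb (λ x → ⟦ does (quotient b x Fin.≟ i) ⟧) λ x → 0≤⟦ does (quotient b x Fin.≟ i) ⟧)
    (ℤ.≤-reflexive (trans (∑-combine s b λ x → ⟦ does (quotient b x Fin.≟ i) ⟧)
      (trans (sum-cong-≗ λ q → trans (sum-cong-≗ {b} λ r → cong (λ p → ⟦ does (proj₁ p Fin.≟ i) ⟧) (Fin.remQuot-combine q r))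
          (trans (∑-const b ⟦ does (q Fin.≟ i) ⟧) (trans (ℤ.*-comm (+ b) _) (cong (λ x → ⟦ x ⟧ * + b) (does-≟-sym q i)))))
        (∑-delta i λ _ → + b))))

  strongByBlocks : ∀ {n} P k s .{{_ : ℕ.NonZero s}} →
    + s ≡ + 18 * (((+ 192 * (+ P * + P)) * (+ 192 * (+ P * + P))) * ((+ 192 * (+ P * + P)) * (+ 192 * (+ P * + P)))) →
    0ℤ < + P → s ℕ.≤ n → k ℕ.+ 1 ℕ.≤ n → + P * (+ 2 * + k) + + n ≤ + P * + n →
    (T₀ : Digraph (Fin n)) → IsTournament T₀ →
    ∃[ Xs ] (length Xs ≡ s ℕ.* 3 ℕ.+ ℕ.suc s ℕ.* 3 × IsStrong k (invertAll T₀ Xs))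
  strongByBlocks {n} P k s s≡ 0<P s≤n k+1≤n large T₀ tour = assemble (Balancing.balancedColumns c classSize T₀)
    where
    b : ℕ
    b = ℕ.suc (n / s)
    g : ℤ
    g = + 192 * (+ P * + P)
    n≤sb : n ℕ.≤ s ℕ.* b
    n≤sb = ℕ.≤-trans (ℕ.≤-reflexive (m≡m%n+[m/n]*n n s))
      (ℕ.≤-trans (ℕ.+-monoˡ-≤ ((n / s) ℕ.* s) (ℕ.<⇒≤ (m%n<n n s))) (ℕ.≤-reflexive (ℕ.*-comm b s)))
    c : Fin n → Fin s
    c = block s b n≤sb
    classSize : ∀ i → ∑[ u < n ] ⟦ does (c u Fin.≟ i) ⟧ ≤ + b
    classSize = block-size s b n≤sb
    -- Rounding n / s up to b costs at most s in the product, and s ≤ n since smaller n are treated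
    -- by circular tournaments.
    sb≤2n : + s * + b ≤ + 2 * + n
    sb≤2n = subst₂ _≤_ (ℤ.pos-* s b) (ℤ.pos-* 2 n) (+≤+ (ℕ.≤-trans (ℕ.≤-reflexive (ℕ.*-comm s b))
      (ℕ.+-mono-≤ s≤n (ℕ.≤-trans (m/n*n≤m n s) (ℕ.≤-reflexive (sym (ℕ.+-identityʳ n)))))))
    0≤b : 0ℤ ≤ + b
    0≤b = 0≤pos
    -- The 18 in s is 2 · 9, the 2 absorbing the rounding in s b ≤ 2 n.
    g⁴b≤n : + 9 * ((g * g) * (g * g)) * + b ≤ + n
    g⁴b≤n = *-cancel-≤ {+ 2} (+<+ ℕ.z<s) (subst (_≤ + 2 * + n)
      (trans (cong (_* + b) s≡) (double ((g * g) * (g * g)) (+ b))) sb≤2n)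
      where
      double : ∀ G b → + 18 * G * b ≡ + 2 * (+ 9 * G * b)
      double = solve-∀
    1≤g : 1ℤ ≤ g
    1≤g = *-mono-≤-nonNeg {1ℤ} {+ 192} {1ℤ} 0≤pos 0≤pos (+≤+ (ℕ.s≤s ℕ.z≤n))
      (*-mono-≤-nonNeg {1ℤ} {+ P} {1ℤ} 0≤pos 0≤pos 1≤P 1≤P)
      where
      1≤P : 1ℤ ≤ + P
      1≤P = ℤ.i<j⇒suc[i]≤j 0<P
    0≤g : 0ℤ ≤ g
    0≤g = ℤ.≤-trans (0≤pos {1}) 1≤g
    gb≤n : g * + b ≤ + n
    gb≤n = ℤ.≤-trans (subst₂ _≤_ (ℤ.*-comm (+ b) g) (ℤ.*-comm (+ b) _) (*-monoˡ-≤-0≤ 0≤b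
        (ℤ.≤-trans g≤g² (ℤ.≤-trans g²≤g⁴ g⁴≤9g⁴)))) g⁴b≤n
      where
      0≤g² : 0ℤ ≤ g * g
      0≤g² = 0≤square g
      1≤g² : 1ℤ ≤ g * g
      1≤g² = *-mono-≤-nonNeg {1ℤ} {g} {1ℤ} 0≤pos 0≤pos 1≤g 1≤g
      g≤g² : g ≤ g * g
      g≤g² = subst (_≤ g * g) (ℤ.*-identityʳ g) (*-monoˡ-≤-0≤ 0≤g 1≤g)
      g²≤g⁴ : g * g ≤ (g * g) * (g * g)
      g²≤g⁴ = subst (_≤ (g * g) * (g * g)) (ℤ.*-identityʳ (g * g)) (*-monoˡ-≤-0≤ 0≤g² 1≤g²)
      g⁴≤9g⁴ : (g * g) * (g * g) ≤ + 9 * ((g * g) * (g * g))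
      g⁴≤9g⁴ = ≤-byDifference (+ 8 * ((g * g) * (g * g))) (0≤* (0≤pos {8}) (0≤square (g * g))) (nine ((g * g) * (g * g)))
        where
        nine : ∀ G → + 9 * G ≡ G + + 8 * G
        nine = solve-∀
    -- With s b ≤ 2 n the left side is at most 128 P² b n, which is below g b n ≤ n².
    64P²sb²≤n² : + 64 * (+ P * + P) * (+ s * (+ b * + b)) ≤ + n * + n
    64P²sb²≤n² = ≤-byDifference _
      (0≤+ (0≤* (0≤pos {n}) (0≤- gb≤n)) (0≤+ (0≤* (0≤* (0≤* (0≤pos {64}) (0≤square (+ P))) 0≤b) (0≤- sb≤2n))
        (0≤* (0≤* (0≤* (0≤pos {64}) (0≤square (+ P))) 0≤b) (0≤pos {n}))))
      (combination (+ P) (+ s) (+ b) (+ n))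
      where
      combination : ∀ P s b n → n * n ≡ + 64 * (P * P) * (s * (b * b)) +
        (n * (n - + 192 * (P * P) * b) + (+ 64 * (P * P) * b * (+ 2 * n - s * b) + + 64 * (P * P) * b * n))
      combination = solve-∀
    0<n : 0ℤ < + n
    0<n = +<+ (ℕ.<-≤-trans (ℕ.m<n+m 0 (ℕ.≤-trans (ℕ.s≤s ℕ.z≤n) (ℕ.m≤n+m 1 k))) (subst (ℕ._≤ n) (sym (ℕ.+-identityʳ (k ℕ.+ 1))) k+1≤n))
    assemble : ∃[ Xs ] (length Xs ≡ s ℕ.* 3 × (∀ j → squaredNorm (Balancing.column c classSize j (invertAll T₀ Xs)) ≤ Balancing.columnBound c classSize)) →
      ∃[ Xs ] (length Xs ≡ s ℕ.* 3 ℕ.+ ℕ.suc s ℕ.* 3 × IsStrong k (invertAll T₀ Xs))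
    assemble (Xs , lenXs , columns) = append
      (Completion.complete 0<n P k large D quasi 0<P (invertAll-isTournament Xs tour) k+1≤n c classSize 64P²sb²≤n²)
      where
      D : Digraph (Fin n)
      D = invertAll T₀ Xs
      quasi : Quasirandom g D
      quasi = Discrepancy.quasirandom c classSize D columns g 0≤g gb≤n sb≤2n g⁴b≤n
      append : ∃[ Ys ] (length Ys ≡ ℕ.suc s ℕ.* 3 × IsStrong k (invertAll D Ys)) →
        ∃[ Xs ] (length Xs ≡ s ℕ.* 3 ℕ.+ ℕ.suc s ℕ.* 3 × IsStrong k (invertAll T₀ Xs))
      append (Ys , lenYs , strong) = Xs ++ Ys , trans (length-++ Xs) (cong₂ ℕ._+_ lenXs lenYs) ,
        subst (IsStrong k) (sym (invertAll-++ T₀ Xs Ys)) strong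

  abstract
    -- 1 / p plays the role of ε.
    boundedInversions : ∀ p → 0 ℕ.< p → ∃[ m ] (∀ k n (T₀ : Digraph (Fin n)) → IsTournament T₀ →
      p ℕ.* (2 ℕ.* k ℕ.+ 1) ℕ.+ k ℕ.≤ p ℕ.* n →
      ∃[ Xs ] (length Xs ℕ.≤ m × IsStrong k (invertAll T₀ Xs)))
    boundedInversions p 0<p = build (2 ℕ.* p ℕ.+ 1) refl
      where
      build : ∀ P → P ≡ 2 ℕ.* p ℕ.+ 1 → ∃[ m ] (∀ k n (T₀ : Digraph (Fin n)) → IsTournament T₀ →
        p ℕ.* (2 ℕ.* k ℕ.+ 1) ℕ.+ k ℕ.≤ p ℕ.* n →
        ∃[ Xs ] (length Xs ℕ.≤ m × IsStrong k (invertAll T₀ Xs)))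
      build P P≡ = s ℕ.* 3 ℕ.+ ℕ.suc s ℕ.* 3 , λ k n T₀ tour bound → cases k n T₀ tour bound (n ℕ.<? s)
        where
        g s : ℕ
        g = 192 ℕ.* (P ℕ.* P)
        s = 18 ℕ.* ((g ℕ.* g) ℕ.* (g ℕ.* g))
        0<P : 0 ℕ.< P
        0<P = subst (0 ℕ.<_) (sym P≡) (ℕ.m≤n+m 1 (2 ℕ.* p))
        0<s : 0 ℕ.< s
        0<s = ℕ.*-mono-≤ {1} {18} {1} (ℕ.s≤s ℕ.z≤n) (ℕ.*-mono-≤ 1≤g² 1≤g²)
          where
          1≤g : 1 ℕ.≤ g
          1≤g = ℕ.*-mono-≤ {1} {192} {1} (ℕ.s≤s ℕ.z≤n) (ℕ.*-mono-≤ 0<P 0<P)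
          1≤g² : 1 ℕ.≤ g ℕ.* g
          1≤g² = ℕ.*-mono-≤ 1≤g 1≤g
        g≡ : + g ≡ + 192 * (+ P * + P)
        g≡ = trans (ℤ.pos-* 192 (P ℕ.* P)) (cong (+ 192 *_) (ℤ.pos-* P P))
        s≡ : + s ≡ + 18 * (((+ 192 * (+ P * + P)) * (+ 192 * (+ P * + P))) * ((+ 192 * (+ P * + P)) * (+ 192 * (+ P * + P))))
        s≡ = trans (ℤ.pos-* 18 ((g ℕ.* g) ℕ.* (g ℕ.* g))) (cong (+ 18 *_)
          (trans (ℤ.pos-* (g ℕ.* g) (g ℕ.* g)) (cong (λ x → x * x) (trans (ℤ.pos-* g g) (cong (λ x → x * x) g≡)))))
        cases : ∀ k n (T₀ : Digraph (Fin n)) → IsTournament T₀ → p ℕ.* (2 ℕ.* k ℕ.+ 1) ℕ.+ k ℕ.≤ p ℕ.* n →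
          Dec (n ℕ.< s) → ∃[ Xs ] (length Xs ℕ.≤ s ℕ.* 3 ℕ.+ ℕ.suc s ℕ.* 3 × IsStrong k (invertAll T₀ Xs))
        cases k n T₀ tour bound (yes n<s) =
          let Xs , len , strong = strongByLinearlyMany k 2k<n T₀ tour
          in Xs , ℕ.≤-trans (ℕ.≤-reflexive len) (ℕ.≤-trans (ℕ.*-monoˡ-≤ 3 (ℕ.<⇒≤ n<s)) (ℕ.m≤m+n (s ℕ.* 3) (ℕ.suc s ℕ.* 3))) , strong
          where
          2k<n : 2 ℕ.* k ℕ.< n
          2k<n = subst (ℕ._≤ n) (ℕ.+-comm (2 ℕ.* k) 1) (ℕ.*-cancelˡ-≤ p {{ℕ.>-nonZero 0<p}} (ℕ.≤-trans (ℕ.m≤m+n _ k) bound))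
        cases k n T₀ tour bound (no n≮s) =
          let Xs , len , strong = strongByBlocks P k s {{ℕ.>-nonZero 0<s}} s≡ (+<+ 0<P) (ℕ.≮⇒≥ n≮s) k+1≤n large T₀ tour
          in Xs , ℕ.≤-reflexive len , strong
          where
          2k+1≤n : 2 ℕ.* k ℕ.+ 1 ℕ.≤ n
          2k+1≤n = ℕ.*-cancelˡ-≤ p {{ℕ.>-nonZero 0<p}} (ℕ.≤-trans (ℕ.m≤m+n _ k) bound)
          k+1≤n : k ℕ.+ 1 ℕ.≤ n
          k+1≤n = ℕ.≤-trans (ℕ.+-monoˡ-≤ 1 (ℕ.m≤m+n k (k ℕ.+ 0))) 2k+1≤n
          boundℤ : + p * (+ 2 * + k + 1ℤ) + + k ≤ + p * + n
          boundℤ = subst₂ _≤_ (trans (ℤ.pos-+ (p ℕ.* (2 ℕ.* k ℕ.+ 1)) k) (cong (_+ + k)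
              (trans (ℤ.pos-* p (2 ℕ.* k ℕ.+ 1)) (cong (+ p *_)
                (trans (ℤ.pos-+ (2 ℕ.* k) 1) (cong (_+ 1ℤ) (ℤ.pos-* 2 k)))))))
            (ℤ.pos-* p n) (+≤+ bound)
          P≡ℤ : + P ≡ + 2 * + p + 1ℤ
          P≡ℤ = trans (cong +_ P≡) (trans (ℤ.pos-+ (2 ℕ.* p) 1) (cong (_+ 1ℤ) (ℤ.pos-* 2 p)))
          -- The hypothesis gives p (n - 2 k) ≥ k. Doubling it and adding n - 2 k yields (2 p + 1)
          -- (n - 2 k) ≥ n, whence the choice of `P`.
          large : + P * (+ 2 * + k) + + n ≤ + P * + n
          large = subst (λ x → x * (+ 2 * + k) + + n ≤ x * + n) (sym P≡ℤ) (≤-byDifference _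
            (0≤+ (0≤* (0≤pos {2}) (0≤- boundℤ)) (0≤* (0≤pos {2}) (0≤pos {p}))) (combination (+ p) (+ k) (+ n)))
            where
            combination : ∀ p k n → (+ 2 * p + 1ℤ) * n ≡ ((+ 2 * p + 1ℤ) * (+ 2 * k) + n) +
              (+ 2 * (p * n - (p * (+ 2 * k + 1ℤ) + k)) + + 2 * p)
            combination = solve-∀

  -- From real ε to reciprocals of positive integers.

  reciprocal : ℕ → ℚ
  reciprocal p = + 1 ℚ./ ℕ.suc p

  reciprocal-≤ : ∀ q → 0ℚ ℚ.< q → ∃[ p ] reciprocal p ℚ.≤ q
  reciprocal-≤ (mkℚ (+ ℕ.zero)  d _) (ℚ.*<* (+<+ ()))
  reciprocal-≤ (mkℚ -[1+ _ ]    d _) (ℚ.*<* ())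
  -- The stored denominator is one less than the actual one, matching `reciprocal`: (a + 1) / (d +
  -- 1) is at least 1 / (d + 1).
  reciprocal-≤ (mkℚ (+ ℕ.suc a) d c) _ = d , ℚ.toℚᵘ-cancel-≤
    (ℚᵘ.≤-respˡ-≃ (ℚᵘ.≃-sym (ℚ.toℚᵘ-fromℚᵘ (mkℚᵘ (+ 1) d)))
      (ℚᵘ.*≤* (*-mono-≤-nonNeg {1ℤ} {+ ℕ.suc a} {+ ℕ.suc d} 0≤pos 0≤pos (+≤+ (ℕ.s≤s ℕ.z≤n)) ℤ.≤-refl)))

  -- Any reciprocal below x would serve the bound, but a choice read off the given witnesses could
  -- differ between equal reals. The least index depends only on the cut, and it can be found
  -- because cuts are Bool-valued.
  leastReciprocal : (x : ℝ>0) → ∃[ p ] (reciprocal p <ᵣ proj₁ x × (∀ q → reciprocal q <ᵣ proj₁ x → p ℕ.≤ q))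
  leastReciprocal (x , 0<x) =
    let q , 0<q , q<x = ℝ.rounded x 0<x
        p , p≤q = reciprocal-≤ q 0<q
        l , l<x , _ , minimal = least (λ m → T? (ℝ.lower x (reciprocal m))) p (ℝ.downward x p≤q q<x)
    in l , l<x , minimal

  -- Passing to unnormalised rationals undoes the reduction to lowest terms in `fromℕ` and
  -- `reciprocal`, so the order becomes plain cross multiplication.
  clearDenominator : ∀ p c k n → fromℕ c ℚ.+ reciprocal p ℚ.* fromℕ k ℚ.≤ fromℕ n →
                     ℕ.suc p ℕ.* c ℕ.+ k ℕ.≤ ℕ.suc p ℕ.* n
  clearDenominator p c k n bound = ℤ.drop‿+≤+ (subst₂ _≤_
    (trans (left (+ c) (+ ℕ.suc p) (+ k)) (sym (trans (ℤ.pos-+ (ℕ.suc p ℕ.* c) k) (cong (_+ + k) (ℤ.pos-* (ℕ.suc p) c)))))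
    (trans (right (+ n) (+ ℕ.suc p)) (sym (ℤ.pos-* (ℕ.suc p) n)))
    (subst₂ (λ d d′ → (+ c * d + 1ℤ * + k * 1ℤ) * 1ℤ ≤ + n * d′) (ℤ.pos-* (ℕ.suc p) 1)
       (trans (ℤ.pos-* 1 (ℕ.suc p ℕ.* 1)) (cong (1ℤ *_) (ℤ.pos-* (ℕ.suc p) 1))) (ℚᵘ.drop-*≤* boundᵘ)))
    where
    left : ∀ c p k → (c * (p * 1ℤ) + 1ℤ * k * 1ℤ) * 1ℤ ≡ p * c + k
    left = solve-∀
    right : ∀ n p → n * (1ℤ * (p * 1ℤ)) ≡ p * n
    right = solve-∀
    boundᵘ : mkℚᵘ (+ c) 0 ℚᵘ.+ mkℚᵘ (+ 1) p ℚᵘ.* mkℚᵘ (+ k) 0 ℚᵘ.≤ mkℚᵘ (+ n) 0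
    boundᵘ = ℚᵘ.≤-respʳ-≃ (ℚ.toℚᵘ-fromℚᵘ (mkℚᵘ (+ n) 0)) (ℚᵘ.≤-respˡ-≃
      (ℚᵘ.≃-trans (ℚ.toℚᵘ-homo-+ (fromℕ c) (reciprocal p ℚ.* fromℕ k))
        (ℚᵘ.+-cong (ℚ.toℚᵘ-fromℚᵘ (mkℚᵘ (+ c) 0))
          (ℚᵘ.≃-trans (ℚ.toℚᵘ-homo-* (reciprocal p) (fromℕ k))
            (ℚᵘ.*-cong (ℚ.toℚᵘ-fromℚᵘ (mkℚᵘ (+ 1) p)) (ℚ.toℚᵘ-fromℚᵘ (mkℚᵘ (+ k) 0))))))
      (ℚ.toℚᵘ-mono-≤ bound))

open Inversions using (sinv-≤)
open Quasirandomness using (boundedInversions; reciprocal; leastReciprocal; clearDenominator)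
open import Data.Nat using (_≤_; _<_; _+_; _*_)

theorem1p15 : Σ (ℝ>0-setoid ⟶ₛ setoid ℕ) λ f →
    (ε : ℝ>0) (k : ℕ) → 0 < k →
    (n : ℕ) (T : Digraph (Fin n)) → IsTournament T →
    (2 * k + 1) + proj₁ ε · k ≤ᵣ n →
    ∃[ m ] (IsSinv k T m × m ≤ f ⟨$⟩ ε)
theorem1p15 = record { to = bound ; cong = λ {x} {y} x≈y → cong budget (index-cong x y x≈y) } ,
  λ x k _ n D tournament large →
    let p , p<x , _ = leastReciprocal x
        Xs , len , strong = proj₂ (boundedInversions (ℕ.suc p) ℕ.z<s) k n D tournament
          (clearDenominator p (2 * k + 1) k n (large (reciprocal p) p<x))
        m , sinv , m≤ = sinv-≤ k D Xs strong
    in m , sinv , ℕ.≤-trans m≤ len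
  where
  budget : ℕ → ℕ
  budget p = proj₁ (boundedInversions (ℕ.suc p) ℕ.z<s)
  index : ℝ>0 → ℕ
  index x = proj₁ (leastReciprocal x)
  bound : ℝ>0 → ℕ
  bound x = budget (index x)
  index-cong : ∀ x y → (∀ q → ℝ.lower (proj₁ x) q ≡ ℝ.lower (proj₁ y) q) → index x ≡ index y
  index-cong x y x≈y = ℕ.≤-antisym
    (proj₂ (proj₂ (leastReciprocal x)) _ (subst T (sym (x≈y _)) (proj₁ (proj₂ (leastReciprocal y)))))
    (proj₂ (proj₂ (leastReciprocal y)) _ (subst T (x≈y _) (proj₁ (proj₂ (leastReciprocal x)))))
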